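{- For each positive integer $d$ there is a constant $c_d$ such that every $(d,\Delta)$-degenerate graph $H$ with $n$ vertices satisfies $r(H) \leq 2^{c_d\sqrt{\log \Delta}}\, n$. In particular, $r(H) \leq 2^{c_d\sqrt{\log n}}\, n$ for every $d$-degenerate graph $H$ on $n$ vertices.
   Context: The Ramsey number $r(H)$ of a graph $H$ is the least positive integer $N$ such that every two-coloring of the edges of the complete graph $K_N$ contains a monochromatic copy of $H$. A graph is $d$-degenerate if every subgraph has a vertex of degree at most $d$. A graph $H$ is $(d,\Delta)$-degenerate if there is an ordering $v_1,\ldots,v_n$ of its vertices such that for each $v_i$: (1) at most $d$ vertices $v_j$ with $j<i$ are adjacent to $v_i$, and (2) there are at most $\Delta$ subsets $S\subset\{v_1,\ldots,v_i\}$ such that $S=N(v_j)\cap\{v_1,\ldots,v_i\}$ for some neighbor $v_j$ of $v_i$ with $j>i$, where $N(v)$ denotes the set of vertices adjacent to $v$. All logarithms are base $2$.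
   Formalization: The bound for (d,Δ)-degenerate graphs is stated for Δ ≥ 2 only: for Δ = 1 it would read r(H) ≤ n, which fails for the star K_{1,3} (it is (d,1)-degenerate, n = 4, r = 6), and for Δ = 0 the logarithm is undefined. -}

module Defs where

open import Data.Nat using (ℕ; zero; suc; _+_; _*_; _^_; _≤_; _<_; _≤ᵇ_)
open import Data.Nat.Logarithm using (⌈log₂_⌉)
open import Data.Bool using (Bool; true; false; if_then_else_; _∧_)
open import Data.Fin using (Fin; toℕ; _<?_) renaming (_<_ to _<ᶠ_; _≤_ to _≤ᶠ_)
open import Data.Fin.Subset using (Subset; _∈_; Nonempty)
open import Data.List using (List; length; filter; allFin)
open import Data.List.Membership.Propositional using () renaming (_∈_ to _∈ˡ_)
open import Data.Vec using (tabulate)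
open import Data.Product using (Σ; ∃; ∃-syntax; _×_; _,_)
open import Relation.Binary.PropositionalEquality using (_≡_)
open import Relation.Nullary.Decidable using (⌊_⌋)
open import Function.Definitions using (Injective)

record Graph (n : ℕ) : Set where
  field
    adj    : Fin n → Fin n → Bool
    sym    : ∀ i j → adj i j ≡ adj j i
    irrefl : ∀ i → adj i i ≡ false
open Graph public

count : ∀ {n} → (Fin n → Bool) → ℕ
count {n} p = length (filter (λ i → p i Data.Bool.≟ true) (allFin n))
  where import Data.Bool

Degenerate : ∀ {n} → ℕ → Graph n → Set
Degenerate {n} d H =
  (U : Subset n) → Nonempty U →
  ∃[ v ] (v ∈ U × count (λ u → adj H v u ∧ Data.Vec.lookup U u) ≤ d)
  where import Data.Vec

-- (d,Δ)-degenerate. The ordering v₁,…,vₙ is given by an injection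
-- π : Fin n → Fin n (v at position k is π k; positions are 0-based).
-- (1) for each position i, at most d positions j < i have v_j adjacent to v_i;
-- (2) for each position i, the sets N(v_j) ∩ {v_1,…,v_i} (encoded as the
--     subset of positions k ≤ i with v_k adjacent to v_j), over all
--     positions j > i with v_j adjacent to v_i, all lie in one list of
--     length ≤ Δ, i.e. there are at most Δ distinct such sets.
DDegenerate : ∀ {n} → ℕ → ℕ → Graph n → Set
DDegenerate {n} d Δ H =
  Σ (Fin n → Fin n) λ π → Injective _≡_ _≡_ π ×
    ((i : Fin n) →
       count (λ j → ⌊ j <? i ⌋ ∧ adj H (π j) (π i)) ≤ d
     × ∃[ L ] (length L ≤ Δ ×
          ((j : Fin n) → i <ᶠ j → adj H (π i) (π j) ≡ true →
             tabulate (λ k → ⌊ k Data.Fin.≤? i ⌋ ∧ adj H (π k) (π j)) ∈ˡ L)))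
  where import Data.Fin

MonoCopy : ∀ {n N} → Graph n → (Fin N → Fin N → Bool) → Set
MonoCopy {n} {N} H col =
  ∃[ b ] ∃[ f ] (Injective _≡_ _≡_ f ×
    ((i j : Fin n) → adj H i j ≡ true → col (f i) (f j) ≡ b))

-- K_N → H : every two-colouring of the edges of K_N contains a monochromatic
-- copy of H.  r(H) ≤ N  iff  Arrows N H  (the property is monotone in N and
-- r(H) is the least N with it).
Arrows : ∀ {n} → ℕ → Graph n → Set
Arrows {n} N H =
  (col : Fin N → Fin N → Bool) → (∀ x y → col x y ≡ col y x) → MonoCopy H col

ceilSqrt : ℕ → ℕ
ceilSqrt m = go m 0
  where
  go : ℕ → ℕ → ℕ
  go zero s = s
  go (suc f) s = if m ≤ᵇ s * s then s else go f (suc s)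

{-# OPTIONS --safe #-}
module Submission where

-- Write R for a colour class and call a q-tuple (T_1,…,T_q) of t-tuples of vertices
-- complete if all vertices of T_i are R-adjacent to all vertices of T_j for i ≠ j; here q = d + 1.
-- An Erdős–Szekeres recursion (pick T in the majority colour and continue inside its common
-- neighbourhood, which typically has density 2^-O(t)) yields a colour with at least
-- 2^-O(t²) N^qt complete tuples.
--
-- For a random complete T let U_i be the common neighbourhood of the T_j with j ≠ i.  Given
-- these T_j, T_i is uniform in U_i^t, so d vertices taken from the other sets U_c, all of which
-- lie in the common neighbourhood of T_i, have fewer than 2^-b |U_i| common neighbours in U_i
-- with probability at most 2^-bt.  Hence some T makes all U_i large and all but a 2^-Ω(t²)
-- fraction of the d-tuples rich in common neighbours.
--
-- The graph is now embedded greedily in the given order, vertices of colour c going to U_c.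
-- The invariant is that for each later vertex few of the completions of its embedded
-- neighbourhood to a d-tuple are bad; only Δ ≤ 2^(t²) distinct neighbourhoods matter in each
-- step, and t = O(√log Δ) gives N = 2^O(t) n.

open import Defs hiding (sym)
open import Data.Bool as Bool using (Bool; true; false; T; _∧_; _∨_; not; if_then_else_)
open import Data.Fin as Fin using (Fin; zero; suc; toℕ; fromℕ<)
open import Data.Fin.Properties using (all?; any?; injective⇒≤; punchOut-injective; toℕ-injective; toℕ<n)
open import Data.Fin.Subset using (Subset; Nonempty)
open import Data.List using (List; []; _∷_; length; map; _++_; cartesianProductWith; allFin; downFrom; filter; upTo)
open import Data.List.Membership.Propositional using () renaming (_∈_ to _∈ˡ_)
open import Data.List.Membership.Propositional.Properties using (∈-allFin; ∈-map⁺; ∈-upTo⁺)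
open import Data.List.Properties using (length-map; length-tabulate; length-upTo; map-tabulate)
open import Data.List.Relation.Unary.Any using (here; there)
open import Data.Nat
open import Data.Nat.Induction using (<-wellFounded)
open import Data.Nat.Logarithm using (⌈log₂_⌉; ⌈log₂⌉-mono-≤)
open import Data.Nat.Logarithm.Core using (⌈log2⌉)
open import Data.Nat.Properties
open import Data.Nat.Tactic.RingSolver using (solve-∀)
open import Data.Product using (Σ; ∃-syntax; _×_; _,_; proj₁; proj₂)
open import Data.Sum using (_⊎_; inj₁; inj₂; swap)
open import Data.Unit using (tt)
open import Data.Vec using (Vec; []; _∷_; lookup; tabulate; _[_]≔_)
open import Data.Vec.Properties using (lookup∘tabulate; lookup∘update; lookup∘update′; lookup⇒[]=; []=⇒lookup)
open import Function using (_∘_)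
open import Function.Definitions using (Injective)
open import Induction.WellFounded using (Acc; acc)
open import Relation.Binary.Definitions using (tri<; tri≈; tri>)
open import Relation.Binary.PropositionalEquality
open import Relation.Nullary using (Dec; yes; no; contradiction; ¬?; _→-dec_)
open import Relation.Nullary.Decidable using (⌊_⌋)

-- Indicators, finite sums and sums over vectors

private variable
  X Y : Set

𝟙 : Bool → ℕ
𝟙 true  = 1
𝟙 false = 0

𝟙-mono : ∀ {a b} → (a ≡ true → b ≡ true) → 𝟙 a ≤ 𝟙 b
𝟙-mono {false} h = z≤n
𝟙-mono {true} {true} h = ≤-refl
𝟙-mono {true} {false} h with () ← h refl

𝟙-∧ : ∀ a b → 𝟙 (a ∧ b) ≡ 𝟙 a * 𝟙 b
𝟙-∧ true  b = sym (+-identityʳ (𝟙 b))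
𝟙-∧ false b = refl

𝟙-guard : ∀ b {m n} → (b ≡ true → m ≤ n) → 𝟙 b * m ≤ 𝟙 b * n
𝟙-guard true  h = *-monoʳ-≤ 1 (h refl)
𝟙-guard false h = z≤n

∧-true : ∀ {a b} → a ∧ b ≡ true → a ≡ true × b ≡ true
∧-true {true} {true} _ = refl , refl

true-∧ : ∀ {a b} → a ≡ true → b ≡ true → a ∧ b ≡ true
true-∧ refl refl = refl

∑ : List X → (X → ℕ) → ℕ
∑ []       f = 0
∑ (x ∷ xs) f = f x + ∑ xs f

∑-mono : ∀ (xs : List X) {f g} → (∀ x → f x ≤ g x) → ∑ xs f ≤ ∑ xs g
∑-mono []       h = z≤n
∑-mono (x ∷ xs) h = +-mono-≤ (h x) (∑-mono xs h)

∑-cong : ∀ (xs : List X) {f g} → (∀ x → f x ≡ g x) → ∑ xs f ≡ ∑ xs g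
∑-cong []       h = refl
∑-cong (x ∷ xs) h = cong₂ _+_ (h x) (∑-cong xs h)

∑-*ˡ : ∀ (xs : List X) c f → ∑ xs (λ x → c * f x) ≡ c * ∑ xs f
∑-*ˡ []       c f = sym (*-zeroʳ c)
∑-*ˡ (x ∷ xs) c f = trans (cong (c * f x +_) (∑-*ˡ xs c f)) (sym (*-distribˡ-+ c (f x) (∑ xs f)))

∑-*ʳ : ∀ (xs : List X) c f → ∑ xs (λ x → f x * c) ≡ ∑ xs f * c
∑-*ʳ xs c f = trans (∑-cong xs (λ x → *-comm (f x) c)) (trans (∑-*ˡ xs c f) (*-comm c (∑ xs f)))

∑-+ : ∀ (xs : List X) f g → ∑ xs (λ x → f x + g x) ≡ ∑ xs f + ∑ xs g
∑-+ []       f g = refl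
∑-+ (x ∷ xs) f g = trans (cong (f x + g x +_) (∑-+ xs f g)) (shuffle (f x) (g x) (∑ xs f) (∑ xs g))
  where
  shuffle : ∀ a b c d → (a + b) + (c + d) ≡ (a + c) + (b + d)
  shuffle = solve-∀

∑-zero : ∀ (xs : List X) → ∑ xs (λ _ → 0) ≡ 0
∑-zero []       = refl
∑-zero (x ∷ xs) = ∑-zero xs

∑-const : ∀ (xs : List X) c → ∑ xs (λ _ → c) ≡ length xs * c
∑-const []       c = refl
∑-const (x ∷ xs) c = cong (c +_) (∑-const xs c)

∑-swap : ∀ (xs : List X) (ys : List Y) (f : X → Y → ℕ) →
         ∑ xs (λ x → ∑ ys (f x)) ≡ ∑ ys (λ y → ∑ xs (λ x → f x y))
∑-swap []       ys f = sym (∑-zero ys)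
∑-swap (x ∷ xs) ys f =
  trans (cong (∑ ys (f x) +_) (∑-swap xs ys f)) (sym (∑-+ ys (f x) (λ y → ∑ xs (λ x → f x y))))

∑-++ : ∀ (xs ys : List X) f → ∑ (xs ++ ys) f ≡ ∑ xs f + ∑ ys f
∑-++ []       ys f = refl
∑-++ (x ∷ xs) ys f = trans (cong (f x +_) (∑-++ xs ys f)) (sym (+-assoc (f x) (∑ xs f) (∑ ys f)))

∑-map : ∀ (g : X → Y) xs f → ∑ (map g xs) f ≡ ∑ xs (λ x → f (g x))
∑-map g []       f = refl
∑-map g (x ∷ xs) f = cong (f (g x) +_) (∑-map g xs f)

∑<∑⇒∃ : ∀ (xs : List X) f g → ∑ xs f < ∑ xs g → ∃[ x ] f x < g x
∑<∑⇒∃ (x ∷ xs) f g lt with f x <? g x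
... | yes p = x , p
... | no ¬p with ∑ xs f <? ∑ xs g
... | yes q = ∑<∑⇒∃ xs f g q
... | no ¬q = contradiction lt (≤⇒≯ (+-mono-≤ (≮⇒≥ ¬p) (≮⇒≥ ¬q)))

*-∑-mono : ∀ (xs : List X) c {f g} → (∀ x → c * f x ≤ g x) → c * ∑ xs f ≤ ∑ xs g
*-∑-mono xs c {f} h = ≤-trans (≤-reflexive (sym (∑-*ˡ xs c f))) (∑-mono xs h)

vecs : ∀ k → List X → List (Vec X k)
vecs zero    xs = [] ∷ []
vecs (suc k) xs = cartesianProductWith _∷_ xs (vecs k xs)

∑-vecs : ∀ k (xs : List X) f →
         ∑ (vecs (suc k) xs) f ≡ ∑ xs (λ x → ∑ (vecs k xs) (λ v → f (x ∷ v)))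
∑-vecs {X} k xs f = go xs
  where
  go : ∀ ys → ∑ (cartesianProductWith _∷_ ys (vecs k xs)) f ≡ ∑ ys (λ x → ∑ (vecs k xs) (λ v → f (x ∷ v)))
  go []       = refl
  go (y ∷ ys) = trans (∑-++ (map (y ∷_) (vecs k xs)) _ f)
                      (cong₂ _+_ (∑-map (y ∷_) (vecs k xs) f) (go ys))

allᵛ : ∀ {k} → (X → Bool) → Vec X k → Bool
allᵛ p []      = true
allᵛ p (x ∷ v) = p x ∧ allᵛ p v

allᵛ-lookup : ∀ {k} (p : X → Bool) (v : Vec X k) → allᵛ p v ≡ true → ∀ a → p (lookup v a) ≡ true
allᵛ-lookup p (x ∷ v) h zero    = let h₁ , _ = ∧-true h in h₁
allᵛ-lookup p (x ∷ v) h (suc a) = let _ , h₂ = ∧-true {p x} h in allᵛ-lookup p v h₂ a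

allᵛ-tabulate : ∀ {k} (p : X → Bool) (v : Vec X k) → (∀ a → p (lookup v a) ≡ true) → allᵛ p v ≡ true
allᵛ-tabulate p []      h = refl
allᵛ-tabulate p (x ∷ v) h = true-∧ (h zero) (allᵛ-tabulate p v (λ a → h (suc a)))

allᵛ-mono : ∀ {k} {p q : X → Bool} → (∀ x → p x ≡ true → q x ≡ true) →
            ∀ (v : Vec X k) → allᵛ p v ≡ true → allᵛ q v ≡ true
allᵛ-mono {p = p} {q} h v hv = allᵛ-tabulate q v (λ a → h _ (allᵛ-lookup p v hv a))

∑-allᵛ : ∀ k (xs : List X) p → ∑ (vecs k xs) (λ v → 𝟙 (allᵛ p v)) ≡ ∑ xs (λ x → 𝟙 (p x)) ^ k
∑-allᵛ zero    xs p = refl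
∑-allᵛ (suc k) xs p = begin
  ∑ (vecs (suc k) xs) (λ v → 𝟙 (allᵛ p v))
    ≡⟨ ∑-vecs k xs _ ⟩
  ∑ xs (λ x → ∑ (vecs k xs) (λ v → 𝟙 (p x ∧ allᵛ p v)))
    ≡⟨ ∑-cong xs (λ x → trans (∑-cong (vecs k xs) (λ v → 𝟙-∧ (p x) (allᵛ p v)))
                               (∑-*ˡ (vecs k xs) (𝟙 (p x)) _)) ⟩
  ∑ xs (λ x → 𝟙 (p x) * ∑ (vecs k xs) (λ v → 𝟙 (allᵛ p v)))
    ≡⟨ ∑-*ʳ xs _ (λ x → 𝟙 (p x)) ⟩
  ∑ xs (λ x → 𝟙 (p x)) * ∑ (vecs k xs) (λ v → 𝟙 (allᵛ p v))
    ≡⟨ cong (∑ xs (λ x → 𝟙 (p x)) *_) (∑-allᵛ k xs p) ⟩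
  ∑ xs (λ x → 𝟙 (p x)) ^ suc k ∎
  where open ≡-Reasoning

length-vecs : ∀ k (xs : List X) → length (vecs k xs) ≡ length xs ^ k
length-vecs k xs = begin
  length (vecs k xs)                             ≡⟨ sym (*-identityʳ _) ⟩
  length (vecs k xs) * 1                         ≡⟨ sym (∑-const (vecs k xs) 1) ⟩
  ∑ (vecs k xs) (λ _ → 1)                        ≡⟨ ∑-cong (vecs k xs) (λ v → cong 𝟙 (sym (allᵛ-tabulate (λ _ → true) v (λ _ → refl)))) ⟩
  ∑ (vecs k xs) (λ v → 𝟙 (allᵛ (λ _ → true) v))  ≡⟨ ∑-allᵛ k xs (λ _ → true) ⟩
  ∑ xs (λ _ → 1) ^ k                             ≡⟨ cong (_^ k) (trans (∑-const xs 1) (*-identityʳ _)) ⟩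
  length xs ^ k                                  ∎
  where open ≡-Reasoning

-- Vectors are grouped into fibres that differ only in entry `i`, and the hypothesis compares the
-- two sums on each fibre. This is how a random tuple is studied conditionally on all its entries
-- but one.
∑-resample : ∀ {k} (xs : List X) (i : Fin k) (f g : Vec X k → ℕ) →
             (∀ v → ∑ xs (λ x → f (v [ i ]≔ x)) ≤ ∑ xs (λ x → g (v [ i ]≔ x))) →
             ∑ (vecs k xs) f ≤ ∑ (vecs k xs) g
∑-resample {k = suc k} xs zero f g h = begin
  ∑ (vecs (suc k) xs) f                                  ≡⟨ ∑-vecs k xs f ⟩
  ∑ xs (λ x → ∑ (vecs k xs) (λ v → f (x ∷ v)))           ≡⟨ ∑-swap xs (vecs k xs) _ ⟩
  ∑ (vecs k xs) (λ v → ∑ xs (λ x → f (x ∷ v)))           ≤⟨ resample xs h ⟩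
  ∑ (vecs k xs) (λ v → ∑ xs (λ x → g (x ∷ v)))           ≡⟨ ∑-swap xs (vecs k xs) _ ⟨
  ∑ xs (λ x → ∑ (vecs k xs) (λ v → g (x ∷ v)))           ≡⟨ ∑-vecs k xs g ⟨
  ∑ (vecs (suc k) xs) g                                  ∎
  where
  open ≤-Reasoning
  -- Instantiating the hypothesis takes a vector with some head, although that head is overwritten.
  -- Any entry of `ys` serves; for empty `ys` both sides are 0.
  resample : ∀ ys → (∀ v → ∑ ys (λ x → f (v [ zero ]≔ x)) ≤ ∑ ys (λ x → g (v [ zero ]≔ x))) →
             ∑ (vecs k xs) (λ v → ∑ ys (λ x → f (x ∷ v))) ≤ ∑ (vecs k xs) (λ v → ∑ ys (λ x → g (x ∷ v)))
  resample []       _  = ∑-mono (vecs k xs) (λ _ → z≤n)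
  resample (y ∷ ys) h′ = ∑-mono (vecs k xs) (λ v → h′ (y ∷ v))
∑-resample {k = suc k} xs (suc i) f g h = begin
  ∑ (vecs (suc k) xs) f                                  ≡⟨ ∑-vecs k xs f ⟩
  ∑ xs (λ x → ∑ (vecs k xs) (λ v → f (x ∷ v)))           ≤⟨ ∑-mono xs (λ x → ∑-resample xs i _ _ (λ v → h (x ∷ v))) ⟩
  ∑ xs (λ x → ∑ (vecs k xs) (λ v → g (x ∷ v)))           ≡⟨ ∑-vecs k xs g ⟨
  ∑ (vecs (suc k) xs) g                                  ∎
  where open ≤-Reasoning

^-distribʳ-* : ∀ m n k → (m * n) ^ k ≡ m ^ k * n ^ k
^-distribʳ-* m n zero    = refl
^-distribʳ-* m n (suc k) = trans (cong (m * n *_) (^-distribʳ-* m n k)) (shuffle m n (m ^ k) (n ^ k))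
  where
  shuffle : ∀ a b c d → a * b * (c * d) ≡ a * c * (b * d)
  shuffle = solve-∀

-- Many monochromatic complete multipartite tuples

⌊⌋-true : ∀ {P : Set} (P? : Dec P) → ⌊ P? ⌋ ≡ true → P
⌊⌋-true (yes p) _ = p

true-⌊⌋ : ∀ {P : Set} (P? : Dec P) → P → ⌊ P? ⌋ ≡ true
true-⌊⌋ (yes _) _ = refl
true-⌊⌋ (no ¬p) p = contradiction p ¬p

module Size {V : Set} (vs : List V) where

  size : (V → Bool) → ℕ
  size A = ∑ vs (λ x → 𝟙 (A x))

  size-mono : ∀ {A B} → (∀ x → A x ≡ true → B x ≡ true) → size A ≤ size B
  size-mono h = ∑-mono vs (λ x → 𝟙-mono (h x))

module HomCount {V : Set} (vs : List V) (t : ℕ) where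

  open Size vs

  tuples : List (Vec V t)
  tuples = vecs t vs

  common : (V → V → Bool) → (V → Bool) → Vec V t → V → Bool
  common R A τ x = A x ∧ allᵛ (λ z → R z x) τ

  -- Homomorphisms of the complete `p`-partite graph with parts of size `t` into `R` on `A`.
  -- Confining the later parts to the common neighbourhood of the first suits the recursion, which
  -- adds one part in front.
  hom : (V → V → Bool) → (V → Bool) → ∀ {p} → Vec (Vec V t) p → Bool
  hom R A []      = true
  hom R A (τ ∷ T) = allᵛ A τ ∧ hom R (common R A τ) T

  #hom : (V → V → Bool) → (V → Bool) → ℕ → ℕ
  #hom R A p = ∑ (vecs p tuples) (λ T → 𝟙 (hom R A T))

  hom-mono : ∀ R {A B} → (∀ x → A x ≡ true → B x ≡ true) →
             ∀ {p} (T : Vec (Vec V t) p) → hom R A T ≡ true → hom R B T ≡ true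
  hom-mono R A⊆B []      h = refl
  hom-mono R {A} {B} A⊆B (τ ∷ T) h with ∧-true {allᵛ A τ} h
  ... | h₁ , h₂ = true-∧ (allᵛ-mono A⊆B τ h₁) (hom-mono R ext T h₂)
    where
    ext : ∀ x → common R A τ x ≡ true → common R B τ x ≡ true
    ext x e with ∧-true {A x} e
    ... | e₁ , e₂ = true-∧ (A⊆B x e₁) e₂

  #hom-mono : ∀ R {A B} p → (∀ x → A x ≡ true → B x ≡ true) → #hom R A p ≤ #hom R B p
  #hom-mono R p A⊆B = ∑-mono (vecs p tuples) (λ T → 𝟙-mono (hom-mono R A⊆B T))

  #hom-suc : ∀ R A p → #hom R A (suc p) ≡ ∑ tuples (λ τ → 𝟙 (allᵛ A τ) * #hom R (common R A τ) p)
  #hom-suc R A p = trans (∑-vecs p tuples _) (∑-cong tuples (λ τ →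
    trans (∑-cong (vecs p tuples) (λ T → 𝟙-∧ (allᵛ A τ) _)) (∑-*ˡ (vecs p tuples) (𝟙 (allᵛ A τ)) _)))

  rich : (V → V → Bool) → (V → Bool) → V → Bool
  rich R A x = A x ∧ ⌊ size A ≤? 2 * size (λ z → A z ∧ R z x) ⌋

  -- Double counting of pairs of a tuple in `A` and a common neighbour in `A`: at least half of `A`
  -- is rich, and a rich vertex is joined to at least half of `A`, hence to all entries of at least
  -- a `2 ^ -t` fraction of the tuples.
  ∑-common : ∀ R A → size A ≤ 2 * size (rich R A) →
    size A * size A ^ t ≤ 2 ^ suc t * ∑ tuples (λ τ → 𝟙 (allᵛ A τ) * size (common R A τ))
  ∑-common R A half = begin
    a * a ^ t                              ≤⟨ *-monoˡ-≤ (a ^ t) half ⟩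
    2 * size (rich R A) * a ^ t            ≡⟨ trans (*-assoc 2 (size (rich R A)) _) (cong (2 *_) (sym (∑-*ʳ vs (a ^ t) _))) ⟩
    2 * ∑ vs (λ x → 𝟙 (rich R A x) * a ^ t)
      ≤⟨ *-monoʳ-≤ 2 (∑-mono vs perVertex) ⟩
    2 * ∑ vs (λ x → 2 ^ t * ∑ tuples (λ τ → F τ x))
      ≡⟨ trans (cong (2 *_) (∑-*ˡ vs (2 ^ t) _)) (sym (*-assoc 2 (2 ^ t) _)) ⟩
    2 ^ suc t * ∑ vs (λ x → ∑ tuples (λ τ → F τ x))
      ≡⟨ cong (2 ^ suc t *_) (∑-swap vs tuples (λ x τ → F τ x)) ⟩
    2 ^ suc t * ∑ tuples (λ τ → ∑ vs (F τ))
      ≡⟨ cong (2 ^ suc t *_) (∑-cong tuples (λ τ → ∑-*ˡ vs (𝟙 (allᵛ A τ)) _)) ⟩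
    2 ^ suc t * ∑ tuples (λ τ → 𝟙 (allᵛ A τ) * size (common R A τ)) ∎
    where
    open ≤-Reasoning
    a = size A
    F : Vec V t → V → ℕ
    F τ x = 𝟙 (allᵛ A τ) * 𝟙 (common R A τ x)

    perVertex : ∀ x → 𝟙 (rich R A x) * a ^ t ≤ 2 ^ t * ∑ tuples (λ τ → F τ x)
    perVertex x with rich R A x in isRich
    ... | false = z≤n
    ... | true with ∧-true {A x} isRich
    ... | Ax , large = begin
      1 * a ^ t                            ≡⟨ *-identityˡ (a ^ t) ⟩
      a ^ t                                ≤⟨ ^-monoˡ-≤ t (⌊⌋-true (a ≤? 2 * size N) large) ⟩
      (2 * size N) ^ t                     ≡⟨ ^-distribʳ-* 2 (size N) t ⟩
      2 ^ t * size N ^ t                   ≡⟨ cong (2 ^ t *_) (sym (∑-allᵛ t vs N)) ⟩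
      2 ^ t * ∑ tuples (λ τ → 𝟙 (allᵛ N τ)) ≤⟨ *-monoʳ-≤ (2 ^ t) (∑-mono tuples split) ⟩
      2 ^ t * ∑ tuples (λ τ → F τ x)       ∎
      where
      N : V → Bool
      N z = A z ∧ R z x
      split : ∀ τ → 𝟙 (allᵛ N τ) ≤ F τ x
      split τ = ≤-trans (𝟙-mono both) (≤-reflexive (𝟙-∧ (allᵛ A τ) (common R A τ x)))
        where
        both : allᵛ N τ ≡ true → allᵛ A τ ∧ common R A τ x ≡ true
        both h = true-∧ (allᵛ-mono (λ z e → let e₁ , _ = ∧-true e in e₁) τ h)
                        (true-∧ Ax (allᵛ-mono (λ z e → let _ , e₂ = ∧-true {A z} e in e₂) τ h))

  -- By `∑-common` the common neighbourhood of a tuple in `A` has average density at least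
  -- `2 ^ -(t + 1)`, so the tuples where it is at least `2 ^ -(t + 2)` carry half of the total. Each
  -- of these starts at least `w / E` homomorphisms.
  extend : ∀ R A p E w → .{{NonZero t}} → size A ≤ 2 * size (rich R A) →
    (∀ A′ → (∀ x → A′ x ≡ true → A x ≡ true) → size A ≤ 2 ^ (t + 2) * size A′ → w ≤ E * #hom R A′ p) →
    size A ^ t * w ≤ 2 ^ (t + 2) * E * #hom R A (suc p)
  extend R A p E w half H = cancel (size A) refl
    where
    open ≤-Reasoning
    a = size A
    K = 2 ^ (t + 2)
    y : Vec V t → ℕ
    y τ = size (common R A τ)
    h : Vec V t → ℕ
    h τ = #hom R (common R A τ) p
    ⊆A : ∀ τ x → common R A τ x ≡ true → A x ≡ true
    ⊆A τ x e = let e₁ , _ = ∧-true e in e₁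

    -- Tuples with a large common neighbourhood are charged to the homomorphisms they extend
    -- to; the others account for at most half of the sum bounded in ∑-common.
    perTuple : ∀ τ → w * K * y τ ≤ w * a + K * a * E * h τ
    perTuple τ with a ≤? K * y τ
    ... | yes big = begin
      w * K * y τ          ≤⟨ *-mono-≤ (*-monoˡ-≤ K (H _ (⊆A τ) big)) (size-mono (⊆A τ)) ⟩
      E * h τ * K * a      ≡⟨ rearrange E (h τ) K a ⟩
      K * a * E * h τ      ≤⟨ m≤n+m _ (w * a) ⟩
      w * a + K * a * E * h τ ∎
      where
      rearrange : ∀ E h K a → E * h * K * a ≡ K * a * E * h
      rearrange = solve-∀
    ... | no small = begin
      w * K * y τ          ≡⟨ *-assoc w K (y τ) ⟩
      w * (K * y τ)        ≤⟨ *-monoʳ-≤ w (<⇒≤ (≰⇒> small)) ⟩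
      w * a                ≤⟨ m≤m+n (w * a) _ ⟩
      w * a + K * a * E * h τ ∎

    K≡ : K ≡ 2 * 2 ^ suc t
    K≡ = cong (2 ^_) (+-comm t 2)

    summed : w * a * a ^ t + w * a * a ^ t ≤ w * a * a ^ t + K * a * E * #hom R A (suc p)
    summed = begin
      w * a * a ^ t + w * a * a ^ t
        ≡⟨ s₁ w a (a ^ t) ⟩
      2 * w * (a * a ^ t)
        ≤⟨ *-monoʳ-≤ (2 * w) (∑-common R A half) ⟩
      2 * w * (2 ^ suc t * ∑ tuples (λ τ → 𝟙 (allᵛ A τ) * y τ))
        ≡⟨ trans (s₂ w (2 ^ suc t) _) (cong (λ k → w * k * S) (sym K≡)) ⟩
      w * K * ∑ tuples (λ τ → 𝟙 (allᵛ A τ) * y τ)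
        ≤⟨ *-∑-mono tuples (w * K) (λ τ → ≤-trans (≤-reflexive (s₃ (w * K) (𝟙 (allᵛ A τ)) (y τ)))
             (*-monoʳ-≤ (𝟙 (allᵛ A τ)) (perTuple τ))) ⟩
      ∑ tuples (λ τ → 𝟙 (allᵛ A τ) * (w * a + K * a * E * h τ))
        ≡⟨ ∑-cong tuples (λ τ → s₄ (𝟙 (allᵛ A τ)) (w * a) (K * a * E) (h τ)) ⟩
      ∑ tuples (λ τ → w * a * 𝟙 (allᵛ A τ) + K * a * E * (𝟙 (allᵛ A τ) * h τ))
        ≡⟨ ∑-+ tuples _ _ ⟩
      ∑ tuples (λ τ → w * a * 𝟙 (allᵛ A τ)) + ∑ tuples (λ τ → K * a * E * (𝟙 (allᵛ A τ) * h τ))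
        ≡⟨ cong₂ _+_ (trans (∑-*ˡ tuples (w * a) _) (cong (w * a *_) (∑-allᵛ t vs A)))
                     (trans (∑-*ˡ tuples (K * a * E) _) (cong (K * a * E *_) (sym (#hom-suc R A p)))) ⟩
      w * a * a ^ t + K * a * E * #hom R A (suc p) ∎
      where
      S = ∑ tuples (λ τ → 𝟙 (allᵛ A τ) * y τ)
      s₁ : ∀ w a b → w * a * b + w * a * b ≡ 2 * w * (a * b)
      s₁ = solve-∀
      s₂ : ∀ w k s → 2 * w * (k * s) ≡ w * (2 * k) * s
      s₂ = solve-∀
      s₃ : ∀ k i y → k * (i * y) ≡ i * (k * y)
      s₃ = solve-∀
      s₄ : ∀ i u v h → i * (u + v * h) ≡ u * i + v * (i * h)
      s₄ = solve-∀

    -- A factor `size A` has to be cancelled. If it is 0, the left side vanishes because `t` is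
    -- nonzero.
    cancel : ∀ s → s ≡ a → s ^ t * w ≤ K * E * #hom R A (suc p)
    cancel zero    _  = ≤-trans (≤-reflexive (cong (_* w) (0^ t))) z≤n
      where
      0^ : ∀ k → .{{NonZero k}} → 0 ^ k ≡ 0
      0^ (suc k) = refl
    cancel (suc s) eq = *-cancelˡ-≤ (suc s) (begin
      suc s * (suc s ^ t * w)           ≡⟨ s₅ (suc s) (suc s ^ t) w ⟩
      w * suc s * suc s ^ t             ≡⟨ cong (λ s → w * s * s ^ t) eq ⟩
      w * a * a ^ t                     ≤⟨ +-cancelˡ-≤ (w * a * a ^ t) _ _ summed ⟩
      K * a * E * #hom R A (suc p)      ≡⟨ s₆ K a E _ ⟩
      a * (K * E * #hom R A (suc p))    ≡⟨ cong (_* (K * E * #hom R A (suc p))) (sym eq) ⟩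
      suc s * (K * E * #hom R A (suc p)) ∎)
      where
      s₅ : ∀ s r w → s * (r * w) ≡ w * s * r
      s₅ = solve-∀
      s₆ : ∀ K a E h → K * a * E * h ≡ a * (K * E * h)
      s₆ = solve-∀

  module Ramsey {{_ : NonZero t}} (q : ℕ) where

    -- The exponent lost in one step of the recursion: `t + 2` for choosing a tuple, and at most
    -- `(t + 2) * (q * t)` because the size of the set, which may shrink by `2 ^ (t + 2)`, enters
    -- with the power `p * t`.
    e : ℕ
    e = (t + 2) * suc (q * t)

    Many : (V → V → Bool) → (V → Bool) → ℕ → ℕ → Set
    Many R A p c = size A ^ (p * t) ≤ 2 ^ c * #hom R A p

    enlarge : ∀ R A A′ p → size A ≤ 2 ^ (t + 2) * size A′ → ∀ {c} → Many R A′ p c →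
              size A ^ (p * t) ≤ 2 ^ ((t + 2) * (p * t)) * 2 ^ c * #hom R A′ p
    enlarge R A A′ p big {c} many = begin
      size A ^ (p * t)                                 ≤⟨ ^-monoˡ-≤ (p * t) big ⟩
      (2 ^ (t + 2) * size A′) ^ (p * t)                ≡⟨ ^-distribʳ-* (2 ^ (t + 2)) (size A′) (p * t) ⟩
      (2 ^ (t + 2)) ^ (p * t) * size A′ ^ (p * t)      ≡⟨ cong (_* size A′ ^ (p * t)) (^-*-assoc 2 (t + 2) (p * t)) ⟩
      2 ^ ((t + 2) * (p * t)) * size A′ ^ (p * t)      ≤⟨ *-monoʳ-≤ (2 ^ ((t + 2) * (p * t))) many ⟩
      2 ^ ((t + 2) * (p * t)) * (2 ^ c * #hom R A′ p)  ≡⟨ *-assoc (2 ^ ((t + 2) * (p * t))) (2 ^ c) _ ⟨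
      2 ^ ((t + 2) * (p * t)) * 2 ^ c * #hom R A′ p    ∎
      where open ≤-Reasoning

    -- If `A` has few `R₂`-homomorphisms, then by monotonicity so has every dense subset `A′`. The
    -- alternative for `R₁` therefore holds on all of them, and `extend` adds a part.
    grow : ∀ R₁ R₂ A p p′ c → p ≤ q → p′ ≤ q → size A ≤ 2 * size (rich R₁ A) →
           (∀ A′ → Many R₁ A′ p c ⊎ Many R₂ A′ p′ c) →
           Many R₁ A (suc p) (e + c) ⊎ Many R₂ A p′ (e + c)
    grow R₁ R₂ A p p′ c p≤q p′≤q half H with size A ^ (p′ * t) ≤? 2 ^ (e + c) * #hom R₂ A p′
    ... | yes many₂ = inj₂ many₂
    ... | no few₂   = inj₁ (begin
      size A ^ (t + p * t)                   ≡⟨ ^-distribˡ-+-* (size A) t (p * t) ⟩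
      size A ^ t * size A ^ (p * t)          ≤⟨ extend R₁ A p (2 ^ ((t + 2) * (p * t)) * 2 ^ c) _ half inner ⟩
      2 ^ (t + 2) * (2 ^ ((t + 2) * (p * t)) * 2 ^ c) * #hom R₁ A (suc p)
                                             ≡⟨ cong (_* #hom R₁ A (suc p)) exponent ⟩
      2 ^ ((t + 2) * suc (p * t) + c) * #hom R₁ A (suc p)
        ≤⟨ *-monoˡ-≤ (#hom R₁ A (suc p)) (^-monoʳ-≤ 2 (+-monoˡ-≤ c (*-monoʳ-≤ (t + 2) (s≤s (*-monoˡ-≤ t p≤q))))) ⟩
      2 ^ (e + c) * #hom R₁ A (suc p)        ∎)
      where
      open ≤-Reasoning
      exponent : 2 ^ (t + 2) * (2 ^ ((t + 2) * (p * t)) * 2 ^ c) ≡ 2 ^ ((t + 2) * suc (p * t) + c)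
      exponent = trans (sym (*-assoc (2 ^ (t + 2)) _ _)) (trans
        (cong (_* 2 ^ c) (trans (sym (^-distribˡ-+-* 2 (t + 2) _)) (cong (2 ^_) (sym (*-suc (t + 2) (p * t))))))
        (sym (^-distribˡ-+-* 2 ((t + 2) * suc (p * t)) c)))
      inner : ∀ A′ → (∀ x → A′ x ≡ true → A x ≡ true) → size A ≤ 2 ^ (t + 2) * size A′ →
              size A ^ (p * t) ≤ 2 ^ ((t + 2) * (p * t)) * 2 ^ c * #hom R₁ A′ p
      inner A′ A′⊆A big with H A′
      ... | inj₁ many = enlarge R₁ A A′ p big {c} many
      ... | inj₂ many = contradiction (begin
        size A ^ (p′ * t)                                 ≤⟨ enlarge R₂ A A′ p′ big {c} many ⟩
        2 ^ ((t + 2) * (p′ * t)) * 2 ^ c * #hom R₂ A′ p′  ≡⟨ cong (_* #hom R₂ A′ p′) (sym (^-distribˡ-+-* 2 ((t + 2) * (p′ * t)) c)) ⟩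
        2 ^ ((t + 2) * (p′ * t) + c) * #hom R₂ A′ p′
          ≤⟨ *-mono-≤ (^-monoʳ-≤ 2 (+-monoˡ-≤ c (*-monoʳ-≤ (t + 2) (≤-trans (*-monoˡ-≤ t p′≤q) (n≤1+n _)))))
                      (#hom-mono R₂ p′ A′⊆A) ⟩
        2 ^ (e + c) * #hom R₂ A p′                        ∎) few₂

    module Colouring (R : Bool → V → V → Bool)
                     (cover : ∀ x y → R true x y ≡ true ⊎ R false x y ≡ true) where

      -- Pigeonhole twice: each vertex of `A` is joined to at least half of `A` in one of the
      -- colours, and one colour serves at least half of the vertices.
      majority : ∀ A → size A ≤ 2 * size (rich (R true) A) ⊎ size A ≤ 2 * size (rich (R false) A)
      majority A with size A ≤? 2 * size (rich (R true) A) | size A ≤? 2 * size (rich (R false) A)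
      ... | yes h | _     = inj₁ h
      ... | no _  | yes h = inj₂ h
      ... | no ¬r | no ¬b = contradiction (halves (size (rich (R true) A)) (size (rich (R false) A)) (≰⇒> ¬r) (≰⇒> ¬b)) (≤⇒≯ total)
        where
        open ≤-Reasoning
        halves : ∀ x y {a} → 2 * x < a → 2 * y < a → x + y < a
        halves x y {a} h₁ h₂ = *-cancelˡ-< 2 _ _ (begin-strict
          2 * (x + y)   ≡⟨ *-distribˡ-+ 2 x y ⟩
          2 * x + 2 * y <⟨ +-mono-< h₁ h₂ ⟩
          a + a         ≡⟨ cong (a +_) (sym (+-identityʳ a)) ⟩
          2 * a         ∎)
        deg : Bool → V → ℕ
        deg b x = size (λ z → A z ∧ R b z x)
        degrees : ∀ x → size A ≤ deg true x + deg false x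
        degrees x = ≤-trans (∑-mono vs perNeighbour) (≤-reflexive (∑-+ vs _ _))
          where
          perNeighbour : ∀ z → 𝟙 (A z) ≤ 𝟙 (A z ∧ R true z x) + 𝟙 (A z ∧ R false z x)
          perNeighbour z with A z | cover z x
          ... | false | _      = z≤n
          ... | true  | inj₁ h rewrite h = s≤s z≤n
          ... | true  | inj₂ h rewrite h = m≤n+m 1 _
        perVertex : ∀ x → 𝟙 (A x) ≤ 𝟙 (rich (R true) A x) + 𝟙 (rich (R false) A x)
        perVertex x with A x
        ... | false = z≤n
        ... | true with size A ≤? 2 * deg true x | size A ≤? 2 * deg false x
        ... | yes _ | _     = s≤s z≤n
        ... | no _  | yes _ = s≤s z≤n
        ... | no ¬r | no ¬b = contradiction (halves (deg true x) (deg false x) (≰⇒> ¬r) (≰⇒> ¬b)) (≤⇒≯ (degrees x))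
        total : size A ≤ size (rich (R true) A) + size (rich (R false) A)
        total = ≤-trans (∑-mono vs perVertex) (≤-reflexive (∑-+ vs _ _))

      -- The Erdős-Szekeres induction: each step lowers the demand in the majority colour by one
      -- part at the cost of a factor `2 ^ e`. A demand of zero parts is met by the empty family.
      ramsey : ∀ p p′ A → p ≤ q → p′ ≤ q →
               Many (R true) A p ((p + p′) * e) ⊎ Many (R false) A p′ ((p + p′) * e)
      ramsey zero    p′   A _ _ = inj₁ (*-mono-≤ (m^n>0 2 (p′ * e)) ≤-refl)
      ramsey (suc p) zero A _ _ = inj₂ (*-mono-≤ (m^n>0 2 ((suc p + 0) * e)) ≤-refl)
      ramsey (suc p) (suc p′) A p<q p′<q with majority A
      ... | inj₁ red = grow (R true) (R false) A p (suc p′) ((p + suc p′) * e) (<⇒≤ p<q) p′<q red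
                         (λ A′ → ramsey p (suc p′) A′ (<⇒≤ p<q) p′<q)
      ... | inj₂ blue rewrite +-suc p p′ =
        swap (grow (R false) (R true) A p′ (suc p) ((suc p + p′) * e) (<⇒≤ p′<q) p<q blue
          (λ A′ → swap (ramsey (suc p) p′ A′ p<q (<⇒≤ p′<q))))

-- Choosing the target sets

≤-∑ : ∀ {X : Set} {x : X} {xs} → x ∈ˡ xs → ∀ f → f x ≤ ∑ xs f
≤-∑ (here refl) f = m≤m+n _ _
≤-∑ (there x∈)  f = ≤-trans (≤-∑ x∈ f) (m≤n+m _ _)

length-allFin : ∀ n → length (allFin n) ≡ n
length-allFin n = length-tabulate {n = n} (λ i → i)

module Extensions {V : Set} (vs : List V) {q : ℕ} (R : V → V → Bool) (b : ℕ) where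

  open Size vs

  -- An edge between two vertices of the same colour class is never needed, so
  -- entries of colour i impose no condition.
  nbr : Fin q → (V → Bool) → List (Fin q × V) → V → Bool
  nbr i S []            y = S y
  nbr i S ((c , x) ∷ P) y = (⌊ c Fin.≟ i ⌋ ∨ R x y) ∧ nbr i S P y

  nbr-mono : ∀ i {S S′ : V → Bool} → (∀ y → S y ≡ true → S′ y ≡ true) →
             ∀ P y → nbr i S P y ≡ true → nbr i S′ P y ≡ true
  nbr-mono i S⊆S′ []            y h = S⊆S′ y h
  nbr-mono i S⊆S′ ((c , x) ∷ P) y h with ∧-true {⌊ c Fin.≟ i ⌋ ∨ R x y} h
  ... | h₁ , h₂ = true-∧ h₁ (nbr-mono i S⊆S′ P y h₂)

  module _ (U : Fin q → V → Bool) where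

    bad : Fin q → List (Fin q × V) → Bool
    bad i P = ⌊ 2 ^ b * size (nbr i (U i) P) <? size (U i) ⌋

    -- Counts the bad extensions by `m` entries. Repeated vertices and entries of colour `i` are
    -- allowed, so the count is a plain sum over the next entry and can be averaged one entry at a
    -- time.
    #bad : Fin q → ℕ → List (Fin q × V) → ℕ
    #bad i zero    P = 𝟙 (bad i P)
    #bad i (suc m) P = ∑ (allFin q) (λ c → ∑ vs (λ x → 𝟙 (U c x) * #bad i m ((c , x) ∷ P)))

module Selection {V : Set} (vs : List V) (t q : ℕ) (R : V → V → Bool) (R-sym : ∀ x y → R x y ≡ R y x) (b g : ℕ) where

  open Size vs
  open HomCount vs t using (tuples; hom; #hom; common)
  open Extensions vs {q} R b

  N = length vs

  Tuple = Vec V t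

  _∼_ : Tuple → V → Bool
  τ ∼ y = allᵛ (λ z → R z y) τ

  U? : ∀ (T : Vec Tuple q) c y → Dec (∀ j → j ≢ c → lookup T j ∼ y ≡ true)
  U? T c y = all? (λ j → ¬? (j Fin.≟ c) →-dec (lookup T j ∼ y) Bool.≟ true)

  U : Vec Tuple q → Fin q → V → Bool
  U T c y = ⌊ U? T c y ⌋

  Hom? : ∀ (T : Vec Tuple q) → Dec (∀ c → allᵛ (U T c) (lookup T c) ≡ true)
  Hom? T = all? (λ c → allᵛ (U T c) (lookup T c) Bool.≟ true)

  Hom : Vec Tuple q → Bool
  Hom T = ⌊ Hom? T ⌋

  -- The part of completeness that does not involve entry `i`. Given it, redrawing that entry keeps
  -- the tuple complete exactly when the new entry lies in `U T i`; this is the uniformity stated by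
  -- `𝟙-Hom`.
  Rest? : ∀ (T : Vec Tuple q) (i : Fin q) → Dec (∀ c → c ≢ i → ∀ j → j ≢ c → j ≢ i → allᵛ (lookup T j ∼_) (lookup T c) ≡ true)
  Rest? T i = all? (λ c → ¬? (c Fin.≟ i) →-dec all? (λ j → ¬? (j Fin.≟ c) →-dec
    (¬? (j Fin.≟ i) →-dec allᵛ (lookup T j ∼_) (lookup T c) Bool.≟ true)))

  Rest : Vec Tuple q → Fin q → Bool
  Rest T i = ⌊ Rest? T i ⌋

  module Resample (T : Vec Tuple q) (i : Fin q) where

    T′ : Tuple → Vec Tuple q
    T′ τ = T [ i ]≔ τ

    U-update : ∀ τ y → U (T′ τ) i y ≡ true → U T i y ≡ true
    U-update τ y h = true-⌊⌋ (U? T i y) (λ j j≢i →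
      subst (λ σ → σ ∼ y ≡ true) (lookup∘update′ j≢i T τ) (⌊⌋-true (U? (T′ τ) i y) h j j≢i))

    update-U : ∀ τ y → U T i y ≡ true → U (T′ τ) i y ≡ true
    update-U τ y h = true-⌊⌋ (U? (T′ τ) i y) (λ j j≢i →
      subst (λ σ → σ ∼ y ≡ true) (sym (lookup∘update′ j≢i T τ)) (⌊⌋-true (U? T i y) h j j≢i))

    size-update : ∀ τ → size (U (T′ τ) i) ≡ size (U T i)
    size-update τ = ≤-antisym (size-mono (U-update τ)) (size-mono (update-U τ))

    Hom⇒⊆U : ∀ τ → Hom (T′ τ) ≡ true → allᵛ (U T i) τ ≡ true
    Hom⇒⊆U τ h = allᵛ-mono (U-update τ) τ
      (subst (λ σ → allᵛ (U (T′ τ) i) σ ≡ true) (lookup∘update i T τ) (⌊⌋-true (Hom? (T′ τ)) h i))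

    Hom⇒Rest : ∀ τ → Hom (T′ τ) ≡ true → Rest T i ≡ true
    Hom⇒Rest τ h = true-⌊⌋ (Rest? T i) (λ c c≢i j j≢c j≢i →
      subst₂ (λ σ ρ → allᵛ (σ ∼_) ρ ≡ true) (lookup∘update′ j≢i T τ) (lookup∘update′ c≢i T τ)
        (allᵛ-mono (λ y e → ⌊⌋-true (U? (T′ τ) c y) e j j≢c) (lookup (T′ τ) c) (⌊⌋-true (Hom? (T′ τ)) h c)))

    Rest⇒Hom : ∀ τ → Rest T i ≡ true → allᵛ (U T i) τ ≡ true → Hom (T′ τ) ≡ true
    Rest⇒Hom τ r τ⊆U = true-⌊⌋ (Hom? (T′ τ)) inside
      where
      inside : ∀ c → allᵛ (U (T′ τ) c) (lookup (T′ τ) c) ≡ true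
      inside c with c Fin.≟ i
      ... | yes refl rewrite lookup∘update c T τ = allᵛ-mono (update-U τ) τ τ⊆U
      ... | no c≢i rewrite lookup∘update′ c≢i T τ =
        allᵛ-tabulate _ (lookup T c) (λ a → true-⌊⌋ (U? (T′ τ) c _) (λ j j≢c → toAll a j j≢c))
        where
        toAll : ∀ a j → j ≢ c → lookup (T′ τ) j ∼ lookup (lookup T c) a ≡ true
        toAll a j j≢c with j Fin.≟ i
        ... | no j≢i rewrite lookup∘update′ j≢i T τ =
          allᵛ-lookup _ (lookup T c) (⌊⌋-true (Rest? T i) r c c≢i j j≢c j≢i) a
        -- Edges from the new entry to entry `c` come from the new entry lying in `U T i`, with the
        -- two ends exchanged by symmetry.
        ... | yes refl rewrite lookup∘update j T τ = allᵛ-tabulate _ τ (λ a′ →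
          trans (R-sym _ _) (allᵛ-lookup _ (lookup T c)
            (⌊⌋-true (U? T i _) (allᵛ-lookup _ τ τ⊆U a′) c c≢i) a))

    𝟙-Hom : ∀ τ → 𝟙 (Hom (T′ τ)) ≡ 𝟙 (Rest T i) * 𝟙 (allᵛ (U T i) τ)
    𝟙-Hom τ = trans (≤-antisym
        (𝟙-mono (λ h → true-∧ (Hom⇒Rest τ h) (Hom⇒⊆U τ h)))
        (𝟙-mono (λ h → let r , s = ∧-true {Rest T i} h in Rest⇒Hom τ r s)))
      (𝟙-∧ (Rest T i) (allᵛ (U T i) τ))

    -- The set `U T i` does not depend on the redrawn entry, which has to lie in it. If the set has
    -- density below `2 ^ -g`, at most a `2 ^ -(g * t)` fraction of all tuples does.
    fewSmall : ∑ tuples (λ τ → 2 ^ (g * t) * (𝟙 (Hom (T′ τ)) * 𝟙 ⌊ 2 ^ g * size (U (T′ τ) i) <? N ⌋))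
               ≤ ∑ tuples (λ _ → 1)
    fewSmall = begin
      ∑ tuples (λ τ → 2 ^ (g * t) * (𝟙 (Hom (T′ τ)) * 𝟙 ⌊ 2 ^ g * size (U (T′ τ) i) <? N ⌋))
        ≤⟨ ∑-mono tuples (λ τ → *-monoʳ-≤ (2 ^ (g * t)) (*-mono-≤ (𝟙-mono (Hom⇒⊆U τ))
             (≤-reflexive (cong (λ s → 𝟙 ⌊ 2 ^ g * s <? N ⌋) (size-update τ))))) ⟩
      ∑ tuples (λ τ → 2 ^ (g * t) * (𝟙 (allᵛ (U T i) τ) * 𝟙 ⌊ 2 ^ g * size (U T i) <? N ⌋))
        ≡⟨ trans (∑-*ˡ tuples (2 ^ (g * t)) _) (cong (2 ^ (g * t) *_) (trans (∑-*ʳ tuples _ _)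
             (cong (_* 𝟙 ⌊ 2 ^ g * size (U T i) <? N ⌋) (∑-allᵛ t vs (U T i))))) ⟩
      2 ^ (g * t) * (size (U T i) ^ t * 𝟙 ⌊ 2 ^ g * size (U T i) <? N ⌋)
        ≤⟨ bound ⟩
      N ^ t
        ≡⟨ sym (trans (∑-const tuples 1) (trans (*-identityʳ _) (length-vecs t vs))) ⟩
      ∑ tuples (λ _ → 1) ∎
      where
      open ≤-Reasoning
      bound : 2 ^ (g * t) * (size (U T i) ^ t * 𝟙 ⌊ 2 ^ g * size (U T i) <? N ⌋) ≤ N ^ t
      bound with 2 ^ g * size (U T i) <? N
      ... | no _ = ≤-trans (≤-reflexive (trans (cong (2 ^ (g * t) *_) (*-zeroʳ (size (U T i) ^ t))) (*-zeroʳ (2 ^ (g * t))))) z≤n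
      ... | yes small = begin
        2 ^ (g * t) * (size (U T i) ^ t * 1)  ≡⟨ cong₂ _*_ (sym (^-*-assoc 2 g t)) (*-identityʳ _) ⟩
        (2 ^ g) ^ t * size (U T i) ^ t        ≡⟨ sym (^-distribʳ-* (2 ^ g) (size (U T i)) t) ⟩
        (2 ^ g * size (U T i)) ^ t            ≤⟨ ^-monoˡ-≤ t (<⇒≤ small) ⟩
        N ^ t ∎

    h : ℕ
    h = ∑ tuples (λ τ → 𝟙 (Hom (T′ τ)))

    N# : List (Fin q × V) → V → Bool
    N# = nbr i (U T i)

    -- For a bad list `P`, a uniform tuple in `U T i` falls into `N# P` with probability at most
    -- `2 ^ -(b * t)`. The indicator that it does is carried along the induction: a further vertex
    -- from `U c` with `c` different from `i` is adjacent to the whole tuple by definition of `U`.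
    -- Each new entry has at most `q * N` choices.
    fewBad : ∀ m P →
      2 ^ (b * t) * ∑ tuples (λ τ → 𝟙 (Hom (T′ τ)) * (𝟙 (allᵛ (N# P) τ) * #bad (U (T′ τ)) i m P)) ≤ (q * N) ^ m * h
    fewBad zero P = begin
      2 ^ (b * t) * ∑ tuples (λ τ → 𝟙 (Hom (T′ τ)) * (𝟙 (allᵛ (N# P) τ) * 𝟙 (bad (U (T′ τ)) i P)))
        ≤⟨ *-monoʳ-≤ (2 ^ (b * t)) (∑-mono tuples perTuple) ⟩
      2 ^ (b * t) * ∑ tuples (λ τ → r * β * 𝟙 (allᵛ (N# P) τ))
        ≡⟨ cong (2 ^ (b * t) *_) (trans (∑-*ˡ tuples (r * β) _) (cong (r * β *_) (∑-allᵛ t vs (N# P)))) ⟩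
      2 ^ (b * t) * (r * β * size (N# P) ^ t)
        ≤⟨ bound ⟩
      r * size (U T i) ^ t
        ≡⟨ sym (trans (∑-cong tuples 𝟙-Hom) (trans (∑-*ˡ tuples r _) (cong (r *_) (∑-allᵛ t vs (U T i))))) ⟩
      h
        ≡⟨ sym (*-identityˡ h) ⟩
      1 * h ∎
      where
      open ≤-Reasoning
      r = 𝟙 (Rest T i)
      β = 𝟙 (bad (U T) i P)
      size-nbr : ∀ τ → size (nbr i (U (T′ τ) i) P) ≡ size (N# P)
      size-nbr τ = ≤-antisym (size-mono (nbr-mono i (U-update τ) P)) (size-mono (nbr-mono i (update-U τ) P))
      perTuple : ∀ τ → 𝟙 (Hom (T′ τ)) * (𝟙 (allᵛ (N# P) τ) * 𝟙 (bad (U (T′ τ)) i P)) ≤ r * β * 𝟙 (allᵛ (N# P) τ)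
      perTuple τ = ≤-trans
        (*-mono-≤ (𝟙-mono (Hom⇒Rest τ)) (≤-reflexive (cong (𝟙 (allᵛ (N# P) τ) *_)
          (cong₂ (λ x y → 𝟙 ⌊ 2 ^ b * x <? y ⌋) (size-nbr τ) (size-update τ)))))
        (≤-reflexive (rearrange r (𝟙 (allᵛ (N# P) τ)) β))
        where
        rearrange : ∀ r x β → r * (x * β) ≡ r * β * x
        rearrange = solve-∀
      bound : 2 ^ (b * t) * (r * β * size (N# P) ^ t) ≤ r * size (U T i) ^ t
      bound with 2 ^ b * size (N# P) <? size (U T i)
      ... | no _ = ≤-trans (≤-reflexive (vanish (2 ^ (b * t)) r (size (N# P) ^ t))) z≤n
        where
        vanish : ∀ k r s → k * (r * 0 * s) ≡ 0
        vanish = solve-∀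
      ... | yes small = begin
        2 ^ (b * t) * (r * 1 * size (N# P) ^ t)  ≡⟨ rearrange (2 ^ (b * t)) r (size (N# P) ^ t) ⟩
        r * (2 ^ (b * t) * size (N# P) ^ t)      ≡⟨ cong (λ k → r * (k * size (N# P) ^ t)) (sym (^-*-assoc 2 b t)) ⟩
        r * ((2 ^ b) ^ t * size (N# P) ^ t)      ≡⟨ cong (r *_) (sym (^-distribʳ-* (2 ^ b) (size (N# P)) t)) ⟩
        r * (2 ^ b * size (N# P)) ^ t            ≤⟨ *-monoʳ-≤ r (^-monoˡ-≤ t (<⇒≤ small)) ⟩
        r * size (U T i) ^ t ∎
        where
        rearrange : ∀ k r s → k * (r * 1 * s) ≡ r * (k * s)
        rearrange = solve-∀
    fewBad (suc m) P = begin
      2 ^ (b * t) * ∑ tuples (λ τ → 𝟙 (Hom (T′ τ)) * (𝟙 (allᵛ (N# P) τ) * #bad (U (T′ τ)) i (suc m) P))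
        ≤⟨ *-monoʳ-≤ (2 ^ (b * t)) (∑-mono tuples (λ τ → *-monoʳ-≤ (𝟙 (Hom (T′ τ))) (perTuple τ))) ⟩
      2 ^ (b * t) * ∑ tuples (λ τ → 𝟙 (Hom (T′ τ)) * ∑ (allFin q) (λ c → ∑ vs (λ x → F τ c x)))
        ≡⟨ cong (2 ^ (b * t) *_) (trans (∑-cong tuples (λ τ → sym (push τ)))
             (trans (∑-swap tuples (allFin q) _) (∑-cong (allFin q) (λ c → ∑-swap tuples vs _)))) ⟩
      2 ^ (b * t) * ∑ (allFin q) (λ c → ∑ vs (λ x → ∑ tuples (λ τ → 𝟙 (Hom (T′ τ)) * F τ c x)))
        ≤⟨ *-∑-mono (allFin q) (2 ^ (b * t)) (λ c → *-∑-mono vs (2 ^ (b * t)) (λ x → fewBad m ((c , x) ∷ P))) ⟩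
      ∑ (allFin q) (λ c → ∑ vs (λ x → (q * N) ^ m * h))
        ≡⟨ trans (∑-cong (allFin q) (λ c → ∑-const vs _)) (trans (∑-const (allFin q) _) (cong (_* (N * ((q * N) ^ m * h))) (length-allFin q))) ⟩
      q * (N * ((q * N) ^ m * h))
        ≡⟨ rearrange q N ((q * N) ^ m) h ⟩
      (q * N) ^ suc m * h ∎
      where
      open ≤-Reasoning
      F : Tuple → Fin q → V → ℕ
      F τ c x = 𝟙 (allᵛ (N# ((c , x) ∷ P)) τ) * #bad (U (T′ τ)) i m ((c , x) ∷ P)
      rearrange : ∀ q N k h → q * (N * (k * h)) ≡ q * N * k * h
      rearrange = solve-∀
      push : ∀ τ → ∑ (allFin q) (λ c → ∑ vs (λ x → 𝟙 (Hom (T′ τ)) * F τ c x)) ≡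
                   𝟙 (Hom (T′ τ)) * ∑ (allFin q) (λ c → ∑ vs (λ x → F τ c x))
      push τ = trans (∑-cong (allFin q) (λ c → ∑-*ˡ vs (𝟙 (Hom (T′ τ))) _)) (∑-*ˡ (allFin q) (𝟙 (Hom (T′ τ))) _)
      perTuple : ∀ τ → 𝟙 (allᵛ (N# P) τ) * #bad (U (T′ τ)) i (suc m) P ≤ ∑ (allFin q) (λ c → ∑ vs (λ x → F τ c x))
      perTuple τ = *-∑-mono (allFin q) (𝟙 (allᵛ (N# P) τ)) (λ c → *-∑-mono vs (𝟙 (allᵛ (N# P) τ)) (λ x →
        ≤-trans (≤-reflexive (trans (sym (*-assoc (𝟙 (allᵛ (N# P) τ)) _ _))
                  (cong (_* #bad (U (T′ τ)) i m ((c , x) ∷ P)) (sym (𝟙-∧ (allᵛ (N# P) τ) (U (T′ τ) c x))))))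
                (*-monoˡ-≤ (#bad (U (T′ τ)) i m ((c , x) ∷ P)) (𝟙-mono (adjoin c x)))))
        where
        adjoin : ∀ c x → allᵛ (N# P) τ ∧ U (T′ τ) c x ≡ true → allᵛ (N# ((c , x) ∷ P)) τ ≡ true
        adjoin c x e with ∧-true {allᵛ (N# P) τ} e
        ... | e₁ , e₂ = allᵛ-tabulate _ τ (λ a → true-∧ (edge a) (allᵛ-lookup _ τ e₁ a))
          where
          edge : ∀ a → ⌊ c Fin.≟ i ⌋ ∨ R x (lookup τ a) ≡ true
          edge a with c Fin.≟ i
          ... | yes _ = refl
          ... | no c≢i = trans (R-sym x _) (allᵛ-lookup _ τ
            (subst (λ σ → σ ∼ x ≡ true) (lookup∘update i T τ) (⌊⌋-true (U? (T′ τ) c x) e₂ i (c≢i ∘ sym))) a)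

  Tuples : List (Vec Tuple q)
  Tuples = vecs q tuples

  #Hom : ℕ
  #Hom = ∑ Tuples (λ T → 𝟙 (Hom T))

  small : Vec Tuple q → Fin q → Bool
  small T i = ⌊ 2 ^ g * size (U T i) <? N ⌋

  ∑-small : ∀ i → 2 ^ (g * t) * ∑ Tuples (λ T → 𝟙 (Hom T) * 𝟙 (small T i)) ≤ N ^ (q * t)
  ∑-small i = begin
    2 ^ (g * t) * ∑ Tuples (λ T → 𝟙 (Hom T) * 𝟙 (small T i))
      ≡⟨ sym (∑-*ˡ Tuples (2 ^ (g * t)) _) ⟩
    ∑ Tuples (λ T → 2 ^ (g * t) * (𝟙 (Hom T) * 𝟙 (small T i)))
      ≤⟨ ∑-resample tuples i (λ T → 2 ^ (g * t) * (𝟙 (Hom T) * 𝟙 (small T i))) (λ _ → 1) (λ T → Resample.fewSmall T i) ⟩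
    ∑ Tuples (λ _ → 1)
      ≡⟨ trans (∑-const Tuples 1) (trans (*-identityʳ _) (trans (length-vecs q tuples) (cong (_^ q) (length-vecs t vs)))) ⟩
    (N ^ t) ^ q
      ≡⟨ trans (^-*-assoc N t q) (cong (N ^_) (*-comm t q)) ⟩
    N ^ (q * t) ∎
    where open ≤-Reasoning

  ∑-bad : ∀ i m → 2 ^ (b * t) * ∑ Tuples (λ T → 𝟙 (Hom T) * #bad (U T) i m []) ≤ (q * N) ^ m * #Hom
  ∑-bad i m = begin
    2 ^ (b * t) * ∑ Tuples (λ T → 𝟙 (Hom T) * #bad (U T) i m [])
      ≡⟨ sym (∑-*ˡ Tuples (2 ^ (b * t)) _) ⟩
    ∑ Tuples f
      ≤⟨ ∑-resample tuples i f f′ perTuple ⟩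
    ∑ Tuples f′
      ≡⟨ ∑-*ˡ Tuples ((q * N) ^ m) _ ⟩
    (q * N) ^ m * #Hom ∎
    where
    open ≤-Reasoning
    f f′ : Vec Tuple q → ℕ
    f T  = 2 ^ (b * t) * (𝟙 (Hom T) * #bad (U T) i m [])
    f′ T = (q * N) ^ m * 𝟙 (Hom T)
    perTuple : ∀ T → ∑ tuples (λ τ → f (T [ i ]≔ τ)) ≤ ∑ tuples (λ τ → f′ (T [ i ]≔ τ))
    perTuple T = begin
      ∑ tuples (λ τ → f (T′ τ))
        ≤⟨ ∑-mono tuples (λ τ → *-monoʳ-≤ (2 ^ (b * t)) (inside τ)) ⟩
      ∑ tuples (λ τ → 2 ^ (b * t) * (𝟙 (Hom (T′ τ)) * (𝟙 (allᵛ (N# []) τ) * #bad (U (T′ τ)) i m [])))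
        ≡⟨ ∑-*ˡ tuples (2 ^ (b * t)) _ ⟩
      2 ^ (b * t) * ∑ tuples (λ τ → 𝟙 (Hom (T′ τ)) * (𝟙 (allᵛ (N# []) τ) * #bad (U (T′ τ)) i m []))
        ≤⟨ fewBad m [] ⟩
      (q * N) ^ m * h
        ≡⟨ sym (∑-*ˡ tuples ((q * N) ^ m) _) ⟩
      ∑ tuples (λ τ → f′ (T′ τ)) ∎
      where
      open Resample T i
      inside : ∀ τ → 𝟙 (Hom (T′ τ)) * #bad (U (T′ τ)) i m [] ≤
                     𝟙 (Hom (T′ τ)) * (𝟙 (allᵛ (N# []) τ) * #bad (U (T′ τ)) i m [])
      inside τ = 𝟙-guard (Hom (T′ τ)) (λ isHom → ≤-reflexive (sym (trans
        (cong (λ x → 𝟙 x * #bad (U (T′ τ)) i m []) (Hom⇒⊆U τ isHom)) (*-identityˡ _))))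

  -- A first moment argument for both requirements at once. Over complete tuples `#small` averages
  -- at most 1/4 and `2 ^ (b * t) * B T` at most `K`, so their combination in `f` averages at most
  -- `3 * K / 2`. Some complete tuple stays below `2 * K`, and the weight `2 * K` on `#small` then
  -- forces it to be 0.
  select : ∀ m → .{{NonZero q}} → .{{NonZero N}} → 4 * q * N ^ (q * t) ≤ 2 ^ (g * t) * #Hom →
           ∃[ T ] ((∀ i → N ≤ 2 ^ g * size (U T i)) ×
                   2 ^ (b * t) * ∑ (allFin q) (λ i → #bad (U T) i m []) < 2 * (q * (q * N) ^ m))
  select m {{q≢0}} {{N≢0}} manyHom = conclude (∑<∑⇒∃ Tuples f (λ T → 𝟙 (Hom T) * (2 * K)) sum<)
    where
    open ≤-Reasoning
    K = q * (q * N) ^ m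
    #small : Vec Tuple q → ℕ
    #small T = ∑ (allFin q) (λ i → 𝟙 (small T i))
    B : Vec Tuple q → ℕ
    B T = ∑ (allFin q) (λ i → #bad (U T) i m [])
    f : Vec Tuple q → ℕ
    f T = 𝟙 (Hom T) * (2 * K * #small T + 2 ^ (b * t) * B T)
    G = 2 ^ (g * t)
    s₁ = ∑ Tuples (λ T → 𝟙 (Hom T) * #small T)
    s₂ = ∑ Tuples (λ T → 𝟙 (Hom T) * B T)

    exchange : ∀ (F : Vec Tuple q → Fin q → ℕ) →
      ∑ Tuples (λ T → 𝟙 (Hom T) * ∑ (allFin q) (F T)) ≡ ∑ (allFin q) (λ i → ∑ Tuples (λ T → 𝟙 (Hom T) * F T i))
    exchange F = trans (∑-cong Tuples (λ T → sym (∑-*ˡ (allFin q) (𝟙 (Hom T)) (F T)))) (∑-swap Tuples (allFin q) _)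

    ∑-const-q : ∀ c → ∑ (allFin q) (λ _ → c) ≡ q * c
    ∑-const-q c = trans (∑-const (allFin q) c) (cong (_* c) (length-allFin q))

    small-total : 4 * s₁ ≤ #Hom
    small-total = *-cancelˡ-≤ G {{m^n≢0 2 (g * t)}} (begin
      G * (4 * s₁)           ≡⟨ rearrange G s₁ ⟩
      4 * (G * s₁)           ≡⟨ cong (λ s → 4 * (G * s)) (exchange _) ⟩
      4 * (G * ∑ (allFin q) (λ i → ∑ Tuples (λ T → 𝟙 (Hom T) * 𝟙 (small T i))))
                             ≤⟨ *-monoʳ-≤ 4 (*-∑-mono (allFin q) G ∑-small) ⟩
      4 * ∑ (allFin q) (λ _ → N ^ (q * t))
                             ≡⟨ trans (cong (4 *_) (∑-const-q _)) (sym (*-assoc 4 q _)) ⟩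
      4 * q * N ^ (q * t)    ≤⟨ manyHom ⟩
      G * #Hom ∎)
      where
      rearrange : ∀ G s → G * (4 * s) ≡ 4 * (G * s)
      rearrange = solve-∀

    bad-total : 2 ^ (b * t) * s₂ ≤ K * #Hom
    bad-total = begin
      2 ^ (b * t) * s₂   ≡⟨ cong (2 ^ (b * t) *_) (exchange _) ⟩
      2 ^ (b * t) * ∑ (allFin q) (λ i → ∑ Tuples (λ T → 𝟙 (Hom T) * #bad (U T) i m []))
                         ≤⟨ *-∑-mono (allFin q) (2 ^ (b * t)) (λ i → ∑-bad i m) ⟩
      ∑ (allFin q) (λ _ → (q * N) ^ m * #Hom)
                         ≡⟨ trans (∑-const-q _) (sym (*-assoc q _ #Hom)) ⟩
      K * #Hom ∎

    ∑f : ∑ Tuples f ≡ 2 * K * s₁ + 2 ^ (b * t) * s₂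
    ∑f = trans (∑-cong Tuples (λ T → rearrange (𝟙 (Hom T)) (2 * K) (#small T) (2 ^ (b * t)) (B T)))
          (trans (∑-+ Tuples _ _) (cong₂ _+_ (∑-*ˡ Tuples (2 * K) _) (∑-*ˡ Tuples (2 ^ (b * t)) _)))
      where
      rearrange : ∀ x k s c b → x * (k * s + c * b) ≡ k * (x * s) + c * (x * b)
      rearrange = solve-∀

    K>0 : 0 < K
    K>0 = *-mono-≤ (>-nonZero⁻¹ q) (m^n>0 (q * N) {{m*n≢0 q N}} m)

    Hom>0 : 0 < #Hom
    Hom>0 = *-cancelˡ-< G 0 #Hom (≤-trans (≤-reflexive (cong suc (*-zeroʳ G)))
      (≤-trans (*-mono-≤ {1} {4 * q} (*-mono-≤ {1} {4} (s≤s z≤n) (>-nonZero⁻¹ q)) (m^n>0 N (q * t))) manyHom))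

    sum< : ∑ Tuples f < ∑ Tuples (λ T → 𝟙 (Hom T) * (2 * K))
    sum< = *-cancelˡ-< 2 _ _ (begin-strict
      2 * ∑ Tuples f                             ≡⟨ trans (cong (2 *_) ∑f) (rearrange K s₁ (2 ^ (b * t) * s₂)) ⟩
      K * (4 * s₁) + 2 * (2 ^ (b * t) * s₂)      ≤⟨ +-mono-≤ (*-monoʳ-≤ K small-total) (*-monoʳ-≤ 2 bad-total) ⟩
      K * #Hom + 2 * (K * #Hom)                  <⟨ m<m+n _ {K * #Hom} (*-mono-≤ K>0 Hom>0) ⟩
      K * #Hom + 2 * (K * #Hom) + K * #Hom       ≡⟨ rearrange′ K #Hom ⟩
      2 * (#Hom * (2 * K))                       ≡⟨ cong (2 *_) (sym (∑-*ʳ Tuples (2 * K) _)) ⟩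
      2 * ∑ Tuples (λ T → 𝟙 (Hom T) * (2 * K))   ∎)
      where
      rearrange : ∀ K s u → 2 * (2 * K * s + u) ≡ K * (4 * s) + 2 * u
      rearrange = solve-∀
      rearrange′ : ∀ K h → K * h + 2 * (K * h) + K * h ≡ 2 * (h * (2 * K))
      rearrange′ = solve-∀

    conclude : ∃[ T ] f T < 𝟙 (Hom T) * (2 * K) →
      ∃[ T ] ((∀ i → N ≤ 2 ^ g * size (U T i)) × 2 ^ (b * t) * B T < 2 * K)
    conclude (T , lt) with Hom T
    ... | false = contradiction lt λ ()
    ... | true  = T , large , ≤-<-trans (m≤n+m _ (2 * K * #small T)) lt′
      where
      lt′ : 2 * K * #small T + 2 ^ (b * t) * B T < 2 * K
      lt′ = subst₂ _<_ (*-identityˡ _) (*-identityˡ (2 * K)) lt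
      large : ∀ i → N ≤ 2 ^ g * size (U T i)
      large i with 2 ^ g * size (U T i) <? N in eq
      ... | no ¬small = ≮⇒≥ ¬small
      ... | yes _ = contradiction lt′ (≤⇒≯ (begin
        2 * K                 ≡⟨ sym (*-identityʳ (2 * K)) ⟩
        2 * K * 1             ≡⟨ cong (λ d → 2 * K * 𝟙 ⌊ d ⌋) (sym eq) ⟩
        2 * K * 𝟙 (small T i) ≤⟨ *-monoʳ-≤ (2 * K) (≤-∑ (∈-allFin i) (λ i → 𝟙 (small T i))) ⟩
        2 * K * #small T      ≤⟨ m≤m+n _ _ ⟩
        2 * K * #small T + 2 ^ (b * t) * B T ∎))

  hom⇒⊆ : ∀ A {p} (T : Vec Tuple p) → hom R A T ≡ true → ∀ c a → A (lookup (lookup T c) a) ≡ true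
  hom⇒⊆ A (τ ∷ T) e zero    a = allᵛ-lookup A τ (proj₁ (∧-true e)) a
  hom⇒⊆ A (τ ∷ T) e (suc c) a =
    proj₁ (∧-true (hom⇒⊆ (common R A τ) T (proj₂ (∧-true {allᵛ A τ} e)) c a))

  -- The recursion in `hom` records edges from earlier to later parts only; symmetry of `R` gives
  -- the opposite direction, as the symmetric condition `Hom` demands.
  hom⇒adjacent : ∀ A {p} (T : Vec Tuple p) → hom R A T ≡ true → ∀ i j → j ≢ i →
                 ∀ a a′ → R (lookup (lookup T j) a) (lookup (lookup T i) a′) ≡ true
  hom⇒adjacent A (τ ∷ T) e zero    zero    j≢i a a′ = contradiction refl j≢i
  hom⇒adjacent A (τ ∷ T) e (suc i) zero    j≢i a a′ =
    allᵛ-lookup _ τ (proj₂ (∧-true {A (lookup (lookup T i) a′)} (hom⇒⊆ (common R A τ) T (proj₂ (∧-true {allᵛ A τ} e)) i a′))) a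
  hom⇒adjacent A (τ ∷ T) e zero    (suc j) j≢i a a′ =
    trans (R-sym _ _) (hom⇒adjacent A (τ ∷ T) e (suc j) zero (j≢i ∘ sym) a′ a)
  hom⇒adjacent A (τ ∷ T) e (suc i) (suc j) j≢i =
    hom⇒adjacent (common R A τ) T (proj₂ (∧-true {allᵛ A τ} e)) i j (j≢i ∘ cong suc)

  hom⇒Hom : ∀ A T → hom R A T ≡ true → Hom T ≡ true
  hom⇒Hom A T e = true-⌊⌋ (Hom? T) (λ i → allᵛ-tabulate _ (lookup T i) (λ a →
    true-⌊⌋ (U? T i _) (λ j j≢i → allᵛ-tabulate _ (lookup T j) (λ a′ → hom⇒adjacent A T e i j j≢i a′ a))))

  #hom≤#Hom : ∀ A → #hom R A q ≤ #Hom
  #hom≤#Hom A = ∑-mono Tuples (λ T → 𝟙-mono (hom⇒Hom A T))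

-- Greedy embedding

∑-allFin-suc : ∀ n (f : Fin (suc n) → ℕ) → ∑ (allFin (suc n)) f ≡ f zero + ∑ (allFin n) (λ i → f (suc i))
∑-allFin-suc n f = cong (f zero +_) (trans (cong (λ xs → ∑ xs f) (sym (map-tabulate {n = n} (λ i → i) suc))) (∑-map suc (allFin n) f))

∑-≟ : ∀ {n} (x : Fin n) → ∑ (allFin n) (λ y → 𝟙 ⌊ x Fin.≟ y ⌋) ≤ 1
∑-≟ {suc n} zero = ≤-reflexive (trans (∑-allFin-suc n (λ y → 𝟙 ⌊ Fin.zero Fin.≟ y ⌋)) (cong suc (∑-zero (allFin n))))
∑-≟ {suc n} (suc x) = ≤-trans (≤-reflexive (∑-allFin-suc n (λ y → 𝟙 ⌊ suc x Fin.≟ y ⌋))) (≤-trans (∑-mono (allFin n) step) (∑-≟ x))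
  where
  step : ∀ y → 𝟙 ⌊ suc x Fin.≟ suc y ⌋ ≤ 𝟙 ⌊ x Fin.≟ y ⌋
  step y with x Fin.≟ y
  ... | yes _ = ≤-refl
  ... | no _  = z≤n

∑ᵣ : ℕ → (ℕ → ℕ) → ℕ
∑ᵣ k = ∑ (downFrom k)

≤-∑ᵣ : ∀ k f {a} → a < k → f a ≤ ∑ᵣ k f
≤-∑ᵣ (suc k) f {a} a<k with a ≟ k
... | yes refl = m≤m+n _ _
... | no a≢k   = ≤-trans (≤-∑ᵣ k f (≤∧≢⇒< (s≤s⁻¹ a<k) a≢k)) (m≤n+m _ (f k))

∑ᵣ-mono-range : ∀ {k l} f → k ≤ l → ∑ᵣ k f ≤ ∑ᵣ l f
∑ᵣ-mono-range {l = zero}  f z≤n = z≤n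
∑ᵣ-mono-range {k} {suc l} f k≤l with k ≟ suc l
... | yes refl = ≤-refl
... | no k≢l   = ≤-trans (∑ᵣ-mono-range f (s≤s⁻¹ (≤∧≢⇒< k≤l k≢l))) (m≤n+m _ (f l))

-- Condition (2) of (d,Δ)-degeneracy: L lists the sets N(v_j) ∩ {v_0,…,v_k}, as predicates
-- whose values at positions after k are irrelevant.
FewTraces : (ℕ → ℕ → Bool) → ℕ → ℕ → Set
FewTraces adjacent Δ n = ∀ k → k < n → Σ (List (ℕ → Bool)) λ L → (length L ≤ Δ ×
  (∀ j → k < j → j < n → adjacent k j ≡ true →
    ∃[ s ] (s ∈ˡ L × (∀ a → a ≤ k → s a ≡ adjacent a j))))

update : {X : Set} → ℕ → X → (ℕ → X) → ℕ → X
update k x f a = if ⌊ a ≟ k ⌋ then x else f a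

update-new : ∀ {X : Set} k (x : X) f → update k x f k ≡ x
update-new k x f with k ≟ k
... | yes _  = refl
... | no k≢k = contradiction refl k≢k

update-old : ∀ {X : Set} k (x : X) f a → a < k → update k x f a ≡ f a
update-old k x f a a<k with a ≟ k
... | yes refl = contradiction a<k (<-irrefl refl)
... | no _     = refl

-- At each step fewer than `n` vertices are occupied and at most `M` are ruled out for destroying
-- the invariant, hence the `n + M` in `room`. The number `D` bounds the traces to be protected.
module Embedding
  {N q : ℕ} (R : Fin N → Fin N → Bool) (U : Fin q → Fin N → Bool)
  (d b n M D : ℕ) .{{_ : NonZero D}} .{{_ : NonZero M}} (d<q : d < q)
  (room : ∀ i → 2 ^ b * (n + M) ≤ Size.size (allFin N) (U i))
  where

  vs = allFin N
  open Size vs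
  open Extensions vs {q} R b

  Placed = List (Fin q × Fin N)

  #B : ℕ → Placed → ℕ
  #B m P = ∑ (allFin q) (λ i → #bad U i m P)

  -- A random extension of P by m further entries is bad with probability below (M / D)^m,
  -- up to the normalisation of the number of choices for each entry.
  Good : ℕ → Placed → Set
  Good m P = #B m P * D ^ m < M ^ m

  Good? : ∀ m P → Dec (Good m P)
  Good? m P = #B m P * D ^ m <? M ^ m

  #B-suc : ∀ m P → #B (suc m) P ≡ ∑ (allFin q) (λ c → ∑ vs (λ x → 𝟙 (U c x) * #B m ((c , x) ∷ P)))
  #B-suc m P = trans (∑-swap (allFin q) (allFin q) _) (∑-cong (allFin q) (λ c →
    trans (∑-swap (allFin q) vs _) (∑-cong vs (λ x → ∑-*ˡ (allFin q) (𝟙 (U c x)) _))))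

  spoils : ℕ → Placed → Fin q → Fin N → Bool
  spoils m P c x = U c x ∧ not ⌊ Good? m ((c , x) ∷ P) ⌋

  -- Markov's inequality: each spoiling vertex accounts for at least `(M / D) ^ m` in the sum of
  -- `#B-suc`, whose total is below `(M / D) ^ suc m`.
  fewSpoil : ∀ m P → Good (suc m) P → ∀ c → D * size (spoils m P c) ≤ M
  fewSpoil m P good c = <⇒≤ (*-cancelʳ-< (M ^ m) _ _ (begin-strict
    D * size (spoils m P c) * M ^ m
      ≡⟨ trans (*-assoc D _ _) (cong (D *_) (sym (∑-*ʳ vs (M ^ m) _))) ⟩
    D * ∑ vs (λ x → 𝟙 (spoils m P c x) * M ^ m)
      ≤⟨ *-monoʳ-≤ D (∑-mono vs perVertex) ⟩
    D * ∑ vs (λ x → D ^ m * (𝟙 (U c x) * #B m ((c , x) ∷ P)))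
      ≡⟨ trans (cong (D *_) (∑-*ˡ vs (D ^ m) _)) (sym (*-assoc D (D ^ m) _)) ⟩
    D ^ suc m * ∑ vs (λ x → 𝟙 (U c x) * #B m ((c , x) ∷ P))
      ≤⟨ *-monoʳ-≤ (D ^ suc m) (≤-∑ (∈-allFin c) (λ c → ∑ vs (λ x → 𝟙 (U c x) * #B m ((c , x) ∷ P)))) ⟩
    D ^ suc m * ∑ (allFin q) (λ c → ∑ vs (λ x → 𝟙 (U c x) * #B m ((c , x) ∷ P)))
      ≡⟨ trans (cong (D ^ suc m *_) (sym (#B-suc m P))) (*-comm (D ^ suc m) _) ⟩
    #B (suc m) P * D ^ suc m
      <⟨ good ⟩
    M * M ^ m ∎))
    where
    open ≤-Reasoning
    perVertex : ∀ x → 𝟙 (spoils m P c x) * M ^ m ≤ D ^ m * (𝟙 (U c x) * #B m ((c , x) ∷ P))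
    perVertex x with U c x
    ... | false = z≤n
    ... | true with Good? m ((c , x) ∷ P)
    ... | yes _    = z≤n
    ... | no ¬good = begin
      1 * M ^ m                          ≡⟨ *-identityˡ _ ⟩
      M ^ m                              ≤⟨ ≮⇒≥ ¬good ⟩
      #B m ((c , x) ∷ P) * D ^ m         ≡⟨ trans (*-comm _ (D ^ m)) (cong (D ^ m *_) (sym (*-identityˡ _))) ⟩
      D ^ m * (1 * #B m ((c , x) ∷ P))   ∎

  M≤U : ∀ i → M ≤ size (U i)
  M≤U i = ≤-trans (≤-trans (m≤n+m M n) (m≤n*m (n + M) (2 ^ b) {{m^n≢0 2 b}})) (room i)

  bad-∷ : ∀ i w P → bad U i P ≡ true → bad U i (w ∷ P) ≡ true
  bad-∷ i (c , x) P h = true-⌊⌋ (_ <? _) (≤-<-trans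
    (*-monoʳ-≤ (2 ^ b) (size-mono (λ y e → proj₂ (∧-true {⌊ c Fin.≟ i ⌋ ∨ R x y} e)))) (⌊⌋-true (_ <? _) h))

  -- Badness passes to longer lists, so every extension by vertices of `U i` is bad, and there are
  -- at least `M` choices for each entry. A good list therefore cannot itself be bad.
  bad⇒#bad : ∀ i m P → bad U i P ≡ true → M ^ m ≤ #bad U i m P
  bad⇒#bad i zero    P h rewrite h = ≤-refl
  bad⇒#bad i (suc m) P h = begin
    M * M ^ m                             ≤⟨ *-monoˡ-≤ (M ^ m) (M≤U i) ⟩
    size (U i) * M ^ m                    ≡⟨ sym (∑-*ʳ vs (M ^ m) _) ⟩
    ∑ vs (λ x → 𝟙 (U i x) * M ^ m)        ≤⟨ ∑-mono vs (λ x → *-monoʳ-≤ (𝟙 (U i x)) (bad⇒#bad i m _ (bad-∷ i (i , x) P h))) ⟩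
    ∑ vs (λ x → 𝟙 (U i x) * #bad U i m ((i , x) ∷ P))
      ≤⟨ ≤-∑ (∈-allFin i) (λ c → ∑ vs (λ x → 𝟙 (U c x) * #bad U i m ((c , x) ∷ P))) ⟩
    #bad U i (suc m) P                    ∎
    where open ≤-Reasoning

  Good⇒manyNbrs : ∀ m P → Good m P → ∀ i → n + M ≤ size (nbr i (U i) P)
  Good⇒manyNbrs m P good i with bad U i P in isBad
  ... | true = contradiction good (≤⇒≯ (begin
    M ^ m               ≤⟨ bad⇒#bad i m P isBad ⟩
    #bad U i m P        ≤⟨ ≤-∑ (∈-allFin i) (λ i → #bad U i m P) ⟩
    #B m P              ≤⟨ m≤m*n (#B m P) (D ^ m) {{m^n≢0 D m}} ⟩
    #B m P * D ^ m      ∎))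
    where open ≤-Reasoning
  ... | false with 2 ^ b * size (nbr i (U i) P) <? size (U i)
  ... | no ¬bad = *-cancelˡ-≤ (2 ^ b) {{m^n≢0 2 b}} (≤-trans (room i) (≮⇒≥ ¬bad))

  nbr⇒U : ∀ i S P y → nbr i S P y ≡ true → S y ≡ true
  nbr⇒U i S []            y h = h
  nbr⇒U i S ((c , x) ∷ P) y h = nbr⇒U i S P y (proj₂ (∧-true {⌊ c Fin.≟ i ⌋ ∨ R x y} h))

  nbr⇒R : ∀ i S P y → nbr i S P y ≡ true → ∀ {c x} → (c , x) ∈ˡ P → c ≢ i → R x y ≡ true
  nbr⇒R i S ((c , x) ∷ P) y h (here refl) c≢i with c Fin.≟ i
  ... | yes c≡i = contradiction c≡i c≢i
  ... | no _    = proj₁ (∧-true h)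
  nbr⇒R i S ((c , x) ∷ P) y h (there w∈P) c≢i = nbr⇒R i S P y (proj₂ (∧-true {⌊ c Fin.≟ i ⌋ ∨ R x y} h)) w∈P c≢i

  -- At most `d` entries cannot use up more than `d` colours. With a colour that none of the
  -- embedded neighbours has, no condition in `nbr` is waived, so all edges back to them are
  -- realised.
  freeColour : ∀ (P : Placed) → length P ≤ d → ∃[ c ] (∀ {c′ x} → (c′ , x) ∈ˡ P → c′ ≢ c)
  freeColour P short with ∑<∑⇒∃ (allFin q) (λ c → ∑ P (λ w → 𝟙 ⌊ proj₁ w Fin.≟ c ⌋)) (λ _ → 1) few
    where
    open ≤-Reasoning
    few : ∑ (allFin q) (λ c → ∑ P (λ w → 𝟙 ⌊ proj₁ w Fin.≟ c ⌋)) < ∑ (allFin q) (λ _ → 1)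
    few = begin-strict
      ∑ (allFin q) (λ c → ∑ P (λ w → 𝟙 ⌊ proj₁ w Fin.≟ c ⌋))  ≡⟨ ∑-swap (allFin q) P _ ⟩
      ∑ P (λ w → ∑ (allFin q) (λ c → 𝟙 ⌊ proj₁ w Fin.≟ c ⌋))  ≤⟨ ∑-mono P (λ w → ∑-≟ (proj₁ w)) ⟩
      ∑ P (λ _ → 1)                                           ≡⟨ trans (∑-const P 1) (*-identityʳ _) ⟩
      length P                                                <⟨ ≤-<-trans short d<q ⟩
      q                                                       ≡⟨ sym (trans (∑-const (allFin q) 1) (trans (*-identityʳ _) (length-allFin q))) ⟩
      ∑ (allFin q) (λ _ → 1)                                  ∎
  ... | c , none = c , λ {c′} {x} w∈P c′≡c → contradiction none (≤⇒≯ (≤-trans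
    (≤-reflexive (cong 𝟙 (sym (true-⌊⌋ (c′ Fin.≟ c) c′≡c)))) (≤-∑ w∈P (λ w → 𝟙 ⌊ proj₁ w Fin.≟ c ⌋))))

  -- Latest position first, so embedding one more vertex adds a head to the lists of its later
  -- neighbours and leaves all other lists alone.
  placed : ℕ → (ℕ → Bool) → (ℕ → Fin q × Fin N) → Placed
  placed zero    s f = []
  placed (suc k) s f = if s k then f k ∷ placed k s f else placed k s f

  placed-cong : ∀ k {s s′ f f′} → (∀ a → a < k → s a ≡ s′ a) → (∀ a → a < k → f a ≡ f′ a) → placed k s f ≡ placed k s′ f′
  placed-cong zero    hs hf = refl
  placed-cong (suc k) {s} {s′} {f} {f′} hs hf
    rewrite hs k ≤-refl | hf k ≤-refl | placed-cong k {s} {s′} {f} {f′} (λ a a<k → hs a (m<n⇒m<1+n a<k)) (λ a a<k → hf a (m<n⇒m<1+n a<k)) = refl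

  length-placed : ∀ k s f → length (placed k s f) ≡ ∑ᵣ k (λ a → 𝟙 (s a))
  length-placed zero    s f = refl
  length-placed (suc k) s f with s k
  ... | true  = cong suc (length-placed k s f)
  ... | false = length-placed k s f

  ∈-placed : ∀ k s f {a} → a < k → s a ≡ true → f a ∈ˡ placed k s f
  ∈-placed (suc k) s f {a} a<k sa with a ≟ k
  ... | yes refl rewrite sa = here refl
  ... | no a≢k with s k
  ... | true  = there (∈-placed k s f (≤∧≢⇒< (s≤s⁻¹ a<k) a≢k) sa)
  ... | false = ∈-placed k s f (≤∧≢⇒< (s≤s⁻¹ a<k) a≢k) sa

  module _
    (adjacent : ℕ → ℕ → Bool)
    (fewBack : ∀ k → k < n → ∑ᵣ k (λ a → 𝟙 (adjacent a k)) ≤ d)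
    (fewTraces : FewTraces adjacent D n)
    where

    trace : ℕ → ℕ → Bool
    trace j a = adjacent a j

    record Partial (k : ℕ) (f : ℕ → Fin q × Fin N) : Set where
      field
        edges    : ∀ {a c} → a < c → c < k → adjacent a c ≡ true → R (proj₂ (f a)) (proj₂ (f c)) ≡ true
        distinct : ∀ {a c} → a < c → c < k → proj₂ (f a) ≢ proj₂ (f c)
        good     : ∀ j → k ≤ j → j < n → Good (d ∸ length (placed k (trace j) f)) (placed k (trace j) f)
    open Partial

    short : ∀ {k j} f → k ≤ j → j < n → length (placed k (trace j) f) ≤ d
    short {k} {j} f k≤j j<n = ≤-trans (≤-reflexive (length-placed k (trace j) f))
      (≤-trans (∑ᵣ-mono-range _ k≤j) (fewBack j j<n))

    -- s ranges over a list that may contain sets other than the traces occurring in the graph;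
    -- the first two conditions exclude those for which fewSpoil is not available.
    excluded : ℕ → (ℕ → Fin q × Fin N) → Fin q → (ℕ → Bool) → Fin N → Bool
    excluded k f c s y =
      (⌊ suc (length P) ≤? d ⌋ ∧ ⌊ Good? (d ∸ length P) P ⌋) ∧ spoils (d ∸ suc (length P)) P c y
      where P = placed k s f

    fewExcluded : ∀ k f c s → D * size (excluded k f c s) ≤ M
    fewExcluded k f c s with suc (length (placed k s f)) ≤? d
    ... | no _ = ≤-trans (≤-reflexive (trans (cong (D *_) (∑-zero vs)) (*-zeroʳ D))) z≤n
    ... | yes len<d with Good? (d ∸ length (placed k s f)) (placed k s f)
    ... | no _ = ≤-trans (≤-reflexive (trans (cong (D *_) (∑-zero vs)) (*-zeroʳ D))) z≤n
    ... | yes isGood = fewSpoil (d ∸ suc (length (placed k s f))) (placed k s f)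
      (subst (λ m → Good m (placed k s f)) (+-∸-assoc 1 len<d) isGood) c

    -- At most `k` vertices are used, and each of at most `D` traces excludes at most `M / D` more.
    -- This is less than `n + M`, the number of common neighbours guaranteed by the invariant for
    -- position `k`.
    choose : ∀ k → k < n → ∀ f → Partial k f → ∀ c (L : List (ℕ → Bool)) → length L ≤ D →
      ∃[ y ] (nbr c (U c) (placed k (trace k) f) y ≡ true × (∀ a → a < k → proj₂ (f a) ≢ y) ×
              (∀ {s} → s ∈ˡ L → excluded k f c s y ≡ false))
    choose k k<n f partialf c L short-L = extract (∑<∑⇒∃ vs forbidden (λ y → 𝟙 (nbr c (U c) P y)) few)
      where
      open ≤-Reasoning
      P = placed k (trace k) f
      used excl forbidden : Fin N → ℕ
      used y = ∑ᵣ k (λ a → 𝟙 ⌊ proj₂ (f a) Fin.≟ y ⌋)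
      excl y = ∑ L (λ s → 𝟙 (excluded k f c s y))
      forbidden y = used y + excl y

      fewUsed : ∀ l → ∑ vs (λ y → ∑ᵣ l (λ a → 𝟙 ⌊ proj₂ (f a) Fin.≟ y ⌋)) ≤ l
      fewUsed zero    = ≤-reflexive (∑-zero vs)
      fewUsed (suc l) = ≤-trans (≤-reflexive (∑-+ vs _ _)) (+-mono-≤ (∑-≟ (proj₂ (f l))) (fewUsed l))

      fewExcl : ∑ vs excl ≤ M
      fewExcl = *-cancelˡ-≤ D (begin
        D * ∑ vs excl                               ≡⟨ cong (D *_) (∑-swap vs L _) ⟩
        D * ∑ L (λ s → size (excluded k f c s))     ≤⟨ *-∑-mono L D (fewExcluded k f c) ⟩
        ∑ L (λ _ → M)                               ≡⟨ ∑-const L M ⟩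
        length L * M                                ≤⟨ *-monoˡ-≤ M short-L ⟩
        D * M                                       ∎)

      few : ∑ vs forbidden < size (nbr c (U c) P)
      few = begin-strict
        ∑ vs forbidden              ≡⟨ ∑-+ vs used excl ⟩
        ∑ vs used + ∑ vs excl       ≤⟨ +-mono-≤ (fewUsed k) fewExcl ⟩
        k + M                       <⟨ +-monoˡ-< M k<n ⟩
        n + M                       ≤⟨ Good⇒manyNbrs (d ∸ length P) P (good partialf k ≤-refl k<n) c ⟩
        size (nbr c (U c) P)        ∎

      extract : ∃[ y ] forbidden y < 𝟙 (nbr c (U c) P y) → _
      extract (y , lt) with nbr c (U c) P y in isNbr
      ... | false = contradiction lt λ ()
      ... | true  = y , isNbr ,
        (λ a a<k fa≡y → contradiction lt (≤⇒≯ (begin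
          1                            ≡⟨ cong 𝟙 (sym (true-⌊⌋ (proj₂ (f a) Fin.≟ y) fa≡y)) ⟩
          𝟙 ⌊ proj₂ (f a) Fin.≟ y ⌋    ≤⟨ ≤-∑ᵣ k (λ a → 𝟙 ⌊ proj₂ (f a) Fin.≟ y ⌋) a<k ⟩
          used y                       ≤⟨ m≤m+n (used y) (excl y) ⟩
          forbidden y                  ∎))) ,
        (λ {s} s∈L → notExcluded s s∈L)
        where
        notExcluded : ∀ s → s ∈ˡ L → excluded k f c s y ≡ false
        notExcluded s s∈L with excluded k f c s y in isExcl
        ... | false = refl
        ... | true  = contradiction lt (≤⇒≯ (begin
          1                            ≡⟨ cong 𝟙 (sym isExcl) ⟩
          𝟙 (excluded k f c s y)       ≤⟨ ≤-∑ s∈L (λ s → 𝟙 (excluded k f c s y)) ⟩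
          excl y                       ≤⟨ m≤n+m (excl y) (used y) ⟩
          forbidden y                  ∎))

    extendPartial : ∀ k → k < n → ∀ f → Partial k f → ∃[ f′ ] Partial (suc k) f′
    extendPartial k k<n f partialf
      with freeColour (placed k (trace k) f) (short f ≤-refl k<n) | fewTraces k k<n
    ... | c , free | L , short-L , traces with choose k k<n f partialf c L short-L
    ... | y , isNbr , fresh , notExcluded = f′ , record { edges = edges′ ; distinct = distinct′ ; good = good′ }
      where
      f′ : ℕ → Fin q × Fin N
      f′ = update k (c , y) f

      f′-old : ∀ a → a < k → f′ a ≡ f a
      f′-old = update-old k (c , y) f

      edges′ : ∀ {a e} → a < e → e < suc k → adjacent a e ≡ true → R (proj₂ (f′ a)) (proj₂ (f′ e)) ≡ true
      edges′ {a} {e} a<e e≤k adj with e ≟ k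
      ... | no e≢k rewrite f′-old a (<-trans a<e (≤∧≢⇒< (s≤s⁻¹ e≤k) e≢k)) =
        edges partialf a<e (≤∧≢⇒< (s≤s⁻¹ e≤k) e≢k) adj
      ... | yes refl rewrite f′-old a a<e =
        nbr⇒R c (U c) (placed k (trace k) f) y isNbr w∈ (free w∈)
        where w∈ = ∈-placed k (trace k) f a<e adj

      distinct′ : ∀ {a e} → a < e → e < suc k → proj₂ (f′ a) ≢ proj₂ (f′ e)
      distinct′ {a} {e} a<e e≤k with e ≟ k
      ... | no e≢k rewrite f′-old a (<-trans a<e (≤∧≢⇒< (s≤s⁻¹ e≤k) e≢k)) =
        distinct partialf a<e (≤∧≢⇒< (s≤s⁻¹ e≤k) e≢k)
      ... | yes refl rewrite f′-old a a<e = fresh a a<e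

      placed-old : ∀ s → placed k s f′ ≡ placed k s f
      placed-old s = placed-cong k (λ _ _ → refl) f′-old

      good′ : ∀ j → suc k ≤ j → j < n → Good (d ∸ length (placed (suc k) (trace j) f′)) (placed (suc k) (trace j) f′)
      good′ j k<j j<n with trace j k in adj | short {suc k} {j} f′ k<j j<n
      ... | false | _ rewrite placed-old (trace j) = good partialf j (<⇒≤ k<j) j<n
      -- The trace of `j` agrees up to `k` with a listed `s`, so both give the same placed list. As
      -- `s` does not exclude `y`, the list remains good with `y` in front.
      ... | true | len≤d rewrite update-new k (c , y) f | placed-old (trace j) with traces j k<j j<n adj
      ... | s , s∈L , agree =
        subst (λ P → Good (d ∸ suc (length P)) ((c , y) ∷ P)) same stillGood
        where
        same : placed k s f ≡ placed k (trace j) f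
        same = placed-cong k (λ a a<k → agree a (<⇒≤ a<k)) (λ _ _ → refl)
        P = placed k s f
        stillGood : Good (d ∸ suc (length P)) ((c , y) ∷ P)
        stillGood with Good? (d ∸ suc (length P)) ((c , y) ∷ P) in eq
        ... | yes isGood = isGood
        ... | no _ = contradiction
          (true-∧ (true-∧ (true-⌊⌋ (_ ≤? _) (subst (λ P → suc (length P) ≤ d) (sym same) len≤d))
                          (true-⌊⌋ (Good? (d ∸ length P) P) (subst (λ P → Good (d ∸ length P) P) (sym same) (good partialf j (<⇒≤ k<j) j<n))))
                  (true-∧ (nbr⇒U c (U c) (placed k (trace k) f) y isNbr) (cong (λ x → not ⌊ x ⌋) eq)))
          (λ excl → contradiction (trans (sym excl) (notExcluded s∈L)) λ ())

    embedUpTo : (Fin q × Fin N) → Good d [] → ∀ k → k ≤ n → ∃[ f ] Partial k f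
    -- Nothing is placed yet; `w₀` is a dummy value.
    embedUpTo w₀ start zero    _   = (λ _ → w₀) , record
      { edges = λ _ () ; distinct = λ _ () ; good = λ _ _ _ → start }
    embedUpTo w₀ start (suc k) k<n = let f , partialf = embedUpTo w₀ start k (<⇒≤ k<n) in extendPartial k k<n f partialf

-- Vertex orderings

count≡∑ : ∀ {n} (p : Fin n → Bool) → count p ≡ ∑ (allFin n) (λ i → 𝟙 (p i))
count≡∑ {n} p = go (allFin n)
  where
  go : ∀ xs → length (filter (λ i → p i Bool.≟ true) xs) ≡ ∑ xs (λ i → 𝟙 (p i))
  go []       = refl
  go (x ∷ xs) with p x
  ... | true  = cong suc (go xs)
  ... | false = go xs

∑ᵣ-mono : ∀ k {f g} → (∀ a → a < k → f a ≤ g a) → ∑ᵣ k f ≤ ∑ᵣ k g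
∑ᵣ-mono zero    h = z≤n
∑ᵣ-mono (suc k) h = +-mono-≤ (h k ≤-refl) (∑ᵣ-mono k (λ a a<k → h a (m<n⇒m<1+n a<k)))

∑ᵣ-first : ∀ k f → ∑ᵣ (suc k) f ≡ f 0 + ∑ᵣ k (f ∘ suc)
∑ᵣ-first zero    f = refl
∑ᵣ-first (suc k) f = trans (cong (f (suc k) +_) (∑ᵣ-first k f)) (exchange (f (suc k)) (f 0) (∑ᵣ k (f ∘ suc)))
  where
  exchange : ∀ a b c → a + (b + c) ≡ b + (a + c)
  exchange = solve-∀

-- Arguments beyond the range are sent to the last element.
toFin : ∀ n → ℕ → Fin (suc n)
toFin n       zero    = zero
toFin zero    (suc a) = zero
toFin (suc n) (suc a) = suc (toFin n a)

toℕ-toFin : ∀ n a → a < suc n → toℕ (toFin n a) ≡ a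
toℕ-toFin n       zero    _   = refl
toℕ-toFin zero    (suc a) (s≤s ())
toℕ-toFin (suc n) (suc a) a<n = cong suc (toℕ-toFin n a (s≤s⁻¹ a<n))

∑-toFin : ∀ n f → ∑ (allFin (suc n)) f ≡ ∑ᵣ (suc n) (λ a → f (toFin n a))
∑-toFin zero    f = refl
∑-toFin (suc n) f = trans (∑-allFin-suc (suc n) f)
  (trans (cong (f zero +_) (∑-toFin n (f ∘ suc))) (sym (∑ᵣ-first (suc n) (λ a → f (toFin (suc n) a)))))

-- A missed value could be punched out, leaving an injection into a smaller set.
injective⇒surjective : ∀ {n} (f : Fin n → Fin n) → Injective _≡_ _≡_ f → ∀ y → ∃[ x ] f x ≡ y
injective⇒surjective {suc n} f inj y with any? (λ x → f x Fin.≟ y)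
... | yes hit = hit
... | no miss = contradiction (injective⇒≤ {f = g} g-inj) 1+n≰n
  where
  y≢f : ∀ x → y ≢ f x
  y≢f x y≡fx = miss (x , sym y≡fx)
  g : Fin (suc n) → Fin n
  g x = Fin.punchOut (y≢f x)
  g-inj : Injective _≡_ _≡_ g
  g-inj {x} {x′} eq = inj (punchOut-injective (y≢f x) (y≢f x′) eq)

-- The common form of both degeneracy hypotheses. Positions are natural numbers, with arbitrary
-- values from `n` on, so the embedding is a plain induction on the number of placed vertices.
record VertexOrder (d Δ : ℕ) {n} (H : Graph n) : Set where
  field
    at        : ℕ → Fin n
    at-inj    : ∀ {a c} → a < c → c < n → at a ≢ at c
    fewBack   : ∀ k → k < n → ∑ᵣ k (λ a → 𝟙 (adj H (at a) (at k))) ≤ d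
    fewTraces : FewTraces (λ a c → adj H (at a) (at c)) Δ n

  position : ∀ v → ∃[ a ] (a < n × at a ≡ v)
  position v with injective⇒surjective (at ∘ toℕ) inj v
    where
    inj : Injective _≡_ _≡_ (at ∘ toℕ)
    inj {x} {y} eq with <-cmp (toℕ x) (toℕ y)
    ... | tri< x<y _ _ = contradiction eq (at-inj x<y (toℕ<n y))
    ... | tri≈ _ x≡y _ = toℕ-injective x≡y
    ... | tri> _ _ y<x = contradiction (sym eq) (at-inj y<x (toℕ<n x))
  ... | i , eq = toℕ i , toℕ<n i , eq

DDegenerate⇒VertexOrder : ∀ {d Δ n} (H : Graph n) → 1 ≤ n → DDegenerate d Δ H → VertexOrder d Δ H
DDegenerate⇒VertexOrder {d} {Δ} {suc n} H _ (π , π-inj , conditions) = record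
  { at = at
  ; at-inj = λ {a} {c} a<c c<n eq → <⇒≢ a<c (trans (sym (toℕ-toFin n a (<-trans a<c c<n)))
      (trans (cong toℕ (π-inj eq)) (toℕ-toFin n c c<n)))
  ; fewBack = fewBack
  ; fewTraces = fewTraces
  }
  where
  open ≤-Reasoning
  at : ℕ → Fin (suc n)
  at a = π (toFin n a)

  fewBack : ∀ k → k < suc n → ∑ᵣ k (λ a → 𝟙 (adj H (at a) (at k))) ≤ d
  fewBack k k<n = begin
    ∑ᵣ k (λ a → 𝟙 (adj H (at a) (at k)))          ≤⟨ ∑ᵣ-mono k (λ a a<k → 𝟙-mono (true-∧ (before a a<k))) ⟩
    ∑ᵣ k (λ a → 𝟙 (back (toFin n a)))             ≤⟨ ∑ᵣ-mono-range _ (<⇒≤ k<n) ⟩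
    ∑ᵣ (suc n) (λ a → 𝟙 (back (toFin n a)))       ≡⟨ sym (∑-toFin n _) ⟩
    ∑ (allFin (suc n)) (λ j → 𝟙 (back j))         ≡⟨ sym (count≡∑ back) ⟩
    count back                                    ≤⟨ proj₁ (conditions i) ⟩
    d ∎
    where
    i = toFin n k
    back : Fin (suc n) → Bool
    back j = ⌊ j Fin.<? i ⌋ ∧ adj H (π j) (π i)
    before : ∀ a → a < k → ⌊ toFin n a Fin.<? i ⌋ ≡ true
    before a a<k = true-⌊⌋ (toFin n a Fin.<? i)
      (subst₂ _<_ (sym (toℕ-toFin n a (<-trans a<k k<n))) (sym (toℕ-toFin n k k<n)) a<k)

  fewTraces : FewTraces (λ a c → adj H (at a) (at c)) Δ (suc n)
  fewTraces k k<n with proj₂ (conditions (toFin n k))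
  ... | L , short , complete = map decode L , ≤-trans (≤-reflexive (length-map decode L)) short ,
    λ j k<j j<n kj → decode (S j) , ∈-map⁺ decode (complete (toFin n j)
        (subst₂ _<_ (sym (toℕ-toFin n k k<n)) (sym (toℕ-toFin n j j<n)) k<j) kj) , agree j
    where
    decode : Subset (suc n) → ℕ → Bool
    decode S a = lookup S (toFin n a)
    member : ℕ → Fin (suc n) → Bool
    member j l = ⌊ l Fin.≤? toFin n k ⌋ ∧ adj H (π l) (at j)
    S : ℕ → Subset (suc n)
    S j = tabulate (member j)
    agree : ∀ j a → a ≤ k → decode (S j) a ≡ adj H (at a) (at j)
    agree j a a≤k = trans (lookup∘tabulate (member j) (toFin n a)) (cong (_∧ adj H (at a) (at j))
      (true-⌊⌋ (toFin n a Fin.≤? toFin n k)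
        (subst₂ _≤_ (sym (toℕ-toFin n a (≤-<-trans a≤k k<n))) (sym (toℕ-toFin n k k<n)) a≤k)))

module _ {d n} (H : Graph n) (degenerate : Degenerate d H) where

  private
    record Peeling (A : Fin n → Bool) (m : ℕ) : Set where
      field
        at      : ℕ → Fin n
        inside  : ∀ a → a < m → A (at a) ≡ true
        at-inj  : ∀ {a c} → a < c → c < m → at a ≢ at c
        fewBack : ∀ k → k < m → ∑ᵣ k (λ a → 𝟙 (adj H (at a) (at k))) ≤ d

  ∑ᵣ-injective : ∀ m (at : ℕ → Fin n) → (∀ {a c} → a < c → c < m → at a ≢ at c) → ∀ (p : Fin n → Bool) →
                 ∑ᵣ m (λ a → 𝟙 (p (at a))) ≤ ∑ (allFin n) (λ u → 𝟙 (p u))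
  ∑ᵣ-injective m at at-inj p = begin
    ∑ᵣ m (λ a → 𝟙 (p (at a)))
      ≤⟨ ∑-mono (downFrom m) (λ a → ≤-trans
           (≤-reflexive (trans (sym (*-identityˡ _)) (cong (λ x → 𝟙 x * 𝟙 (p (at a))) (sym (true-⌊⌋ (at a Fin.≟ at a) refl)))))
           (≤-∑ (∈-allFin (at a)) (λ u → 𝟙 ⌊ at a Fin.≟ u ⌋ * 𝟙 (p u)))) ⟩
    ∑ᵣ m (λ a → ∑ (allFin n) (λ u → 𝟙 ⌊ at a Fin.≟ u ⌋ * 𝟙 (p u)))
      ≡⟨ ∑-swap (downFrom m) (allFin n) _ ⟩
    ∑ (allFin n) (λ u → ∑ᵣ m (λ a → 𝟙 ⌊ at a Fin.≟ u ⌋ * 𝟙 (p u)))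
      ≤⟨ ∑-mono (allFin n) (λ u → ≤-trans (≤-reflexive (∑-*ʳ (downFrom m) (𝟙 (p u)) (λ a → 𝟙 ⌊ at a Fin.≟ u ⌋)))
           (≤-trans (*-monoˡ-≤ (𝟙 (p u)) (hits m at-inj u)) (≤-reflexive (*-identityˡ _)))) ⟩
    ∑ (allFin n) (λ u → 𝟙 (p u)) ∎
    where
    open ≤-Reasoning
    hits : ∀ m → (∀ {a c} → a < c → c < m → at a ≢ at c) → ∀ u → ∑ᵣ m (λ a → 𝟙 ⌊ at a Fin.≟ u ⌋) ≤ 1
    hits zero    _   u = z≤n
    hits (suc m) inj u with at m Fin.≟ u
    ... | no _     = hits m (λ a<c c<m → inj a<c (m<n⇒m<1+n c<m)) u
    ... | yes refl = s≤s (≤-trans (∑ᵣ-mono m miss) (≤-reflexive (∑-zero (downFrom m))))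
      where
      miss : ∀ a → a < m → 𝟙 ⌊ at a Fin.≟ at m ⌋ ≤ 0
      miss a a<m with at a Fin.≟ at m
      ... | yes eq = contradiction eq (inj a<m ≤-refl)
      ... | no _   = z≤n

  -- The order is built from its end: a vertex `v` with at most `d` neighbours in `A` takes the last
  -- position `m`, and the earlier positions are filled from `A` without `v`, so the back neighbours
  -- of `v` are among those `d`.
  peel : ∀ m A → m ≤ ∑ (allFin n) (λ u → 𝟙 (A u)) → 1 ≤ n → Peeling A m
  peel zero    A _  (s≤s _) = record { at = λ _ → zero ; inside = λ _ () ; at-inj = λ _ () ; fewBack = λ _ () }
  peel (suc m) A m< n≥1 with degenerate (tabulate A) nonempty
    where
    nonempty : Nonempty (tabulate A)
    nonempty with ∑<∑⇒∃ (allFin n) (λ _ → 0) (λ u → 𝟙 (A u))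
                    (≤-trans (s≤s (≤-reflexive (∑-zero (allFin n)))) (≤-trans (s≤s z≤n) m<))
    ... | u , lt with A u in Au
    ... | true = u , lookup⇒[]= u (tabulate A) (trans (lookup∘tabulate A u) Au)
  ... | v , v∈A , few = record { at = at′ ; inside = inside′ ; at-inj = at-inj′ ; fewBack = fewBack′ }
    where
    open ≤-Reasoning
    Av : A v ≡ true
    Av = trans (sym (lookup∘tabulate A v)) ([]=⇒lookup v∈A)

    A′ : Fin n → Bool
    A′ u = A u ∧ not ⌊ v Fin.≟ u ⌋

    enough : m ≤ ∑ (allFin n) (λ u → 𝟙 (A′ u))
    enough = s≤s⁻¹ (begin
      suc m                                                       ≤⟨ m< ⟩
      ∑ (allFin n) (λ u → 𝟙 (A u))                                ≤⟨ ∑-mono (allFin n) split ⟩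
      ∑ (allFin n) (λ u → 𝟙 ⌊ v Fin.≟ u ⌋ + 𝟙 (A′ u))             ≡⟨ ∑-+ (allFin n) _ _ ⟩
      ∑ (allFin n) (λ u → 𝟙 ⌊ v Fin.≟ u ⌋) + ∑ (allFin n) (λ u → 𝟙 (A′ u))
                                                                  ≤⟨ +-monoˡ-≤ _ (∑-≟ v) ⟩
      suc (∑ (allFin n) (λ u → 𝟙 (A′ u))) ∎)
      where
      split : ∀ u → 𝟙 (A u) ≤ 𝟙 ⌊ v Fin.≟ u ⌋ + 𝟙 (A′ u)
      split u with A u | v Fin.≟ u
      ... | false | _     = z≤n
      ... | true  | yes _ = s≤s z≤n
      ... | true  | no _  = s≤s z≤n

    open Peeling (peel m A′ enough n≥1)

    at′ : ℕ → Fin n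
    at′ = update m v at

    at′-old : ∀ a → a < m → at′ a ≡ at a
    at′-old = update-old m v at

    inA′ : ∀ a → a < m → A (at a) ≡ true
    inA′ a a<m = proj₁ (∧-true (inside a a<m))

    at≢v : ∀ a → a < m → at a ≢ v
    at≢v a a<m eq with v Fin.≟ at a | proj₂ (∧-true {A (at a)} (inside a a<m))
    ... | yes _  | ()
    ... | no v≢ | _ = v≢ (sym eq)

    inside′ : ∀ a → a < suc m → A (at′ a) ≡ true
    inside′ a a≤m with a ≟ m
    ... | yes refl = Av
    ... | no a≢m   = inA′ a (≤∧≢⇒< (s≤s⁻¹ a≤m) a≢m)

    at-inj′ : ∀ {a c} → a < c → c < suc m → at′ a ≢ at′ c
    at-inj′ {a} {c} a<c c≤m with c ≟ m
    ... | yes refl rewrite at′-old a a<c = at≢v a a<c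
    ... | no c≢m rewrite at′-old a (<-trans a<c (≤∧≢⇒< (s≤s⁻¹ c≤m) c≢m)) = at-inj a<c (≤∧≢⇒< (s≤s⁻¹ c≤m) c≢m)

    fewBack′ : ∀ k → k < suc m → ∑ᵣ k (λ a → 𝟙 (adj H (at′ a) (at′ k))) ≤ d
    fewBack′ k k≤m with k ≟ m
    ... | no k≢m = ≤-trans (∑ᵣ-mono k (λ a a<k → ≤-reflexive (cong (λ x → 𝟙 (adj H x (at k))) (at′-old a (<-trans a<k k<m)))))
                           (fewBack k k<m)
      where k<m = ≤∧≢⇒< (s≤s⁻¹ k≤m) k≢m
    ... | yes refl = begin
      ∑ᵣ m (λ a → 𝟙 (adj H (at′ a) v))        ≤⟨ ∑ᵣ-mono m (λ a a<m → ≤-trans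
                                                    (≤-reflexive (cong (λ x → 𝟙 (adj H x v)) (at′-old a a<m)))
                                                    (𝟙-mono (nbr a a<m))) ⟩
      ∑ᵣ m (λ a → 𝟙 (p (at a)))               ≤⟨ ∑ᵣ-injective m at at-inj p ⟩
      ∑ (allFin n) (λ u → 𝟙 (p u))            ≡⟨ sym (count≡∑ p) ⟩
      count p                                 ≤⟨ few ⟩
      d ∎
      where
      p : Fin n → Bool
      p u = adj H v u ∧ lookup (tabulate A) u
      nbr : ∀ a → a < m → adj H (at a) v ≡ true → p (at a) ≡ true
      nbr a a<m e = true-∧ (trans (Graph.sym H v (at a)) e) (trans (lookup∘tabulate A (at a)) (inA′ a a<m))

  -- The traces of all `n` positions form one list that serves every `k`; hence the value `n` in
  -- place of `Δ`.
  Degenerate⇒VertexOrder : 1 ≤ n → VertexOrder d n H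
  Degenerate⇒VertexOrder n≥1 = record
    { at = at ; at-inj = at-inj ; fewBack = fewBack
    ; fewTraces = λ k k<n → map trace (upTo n) , ≤-reflexive (trans (length-map trace (upTo n)) (length-upTo n)) ,
        λ j k<j j<n _ → trace j , ∈-map⁺ trace (∈-upTo⁺ j<n) , λ _ _ → refl
    }
    where
    open Peeling (peel n (λ _ → true)
      (≤-reflexive (sym (trans (∑-const (allFin n) 1) (trans (*-identityʳ _) (length-allFin n))))) n≥1)
    trace : ℕ → ℕ → Bool
    trace j a = adj H (at a) (at j)

-- Logarithms, square roots and constants

-- The search either stops at a number that passes the test or runs out of fuel at `f + s`, where
-- the bound is the hypothesis.
searchSquare : (go : ℕ → ℕ → ℕ → ℕ) → (∀ m s → go m 0 s ≡ s) →
  (∀ m f s → go m (suc f) s ≡ (if m ≤ᵇ s * s then s else go m f (suc s))) →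
  ∀ m f s → m ≤ (f + s) * (f + s) → ∃[ r ] (r ≡ go m f s × m ≤ r * r)
searchSquare go go-0 go-suc m zero    s m≤ rewrite go-0 m s = s , refl , m≤
searchSquare go go-0 go-suc m (suc f) s m≤ rewrite go-suc m f s with m ≤ᵇ s * s in eq
... | true  = s , refl , ≤ᵇ⇒≤ m (s * s) (subst T (sym eq) tt)
... | false = searchSquare go go-0 go-suc m f (suc s) (subst (λ r → m ≤ r * r) (sym (+-suc f s)) m≤)

-- The search in ceilSqrt is a local function without a name here. With the arguments of
-- its call abstracted to distinct variables, unification recovers it as localSearch.
mutual
  localSearch : ℕ → ℕ → ℕ → ℕ
  localSearch = _

  ceilSqrt-search : ∀ k → ∃[ r ] (r ≡ ceilSqrt (suc k) × suc k ≤ r * r)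
  ceilSqrt-search k with suc k in eq₁ | 1 in eq₂
  -- One unfolding has rejected the root 0, so fuel `k` and start 1 remain.
  ... | m | s = searchSquare localSearch (λ _ _ → refl) (λ _ _ _ → refl) m k s
    (≤-trans (m≤m*n m m {{subst NonZero eq₁ _}}) (≤-reflexive (cong₂ _*_ m≡k+s m≡k+s)))
    where
    m≡k+s : m ≡ k + s
    m≡k+s = trans (sym eq₁) (trans (+-comm 1 k) (cong (k +_) eq₂))

m≤ceilSqrt² : ∀ m → m ≤ ceilSqrt m * ceilSqrt m
m≤ceilSqrt² zero    = z≤n
m≤ceilSqrt² (suc k) with ceilSqrt-search k
... | r , refl , m≤r² = m≤r²

n≤2^⌈log₂n⌉ : ∀ n → n ≤ 2 ^ ⌈log₂ n ⌉
n≤2^⌈log₂n⌉ n = go n (<-wellFounded n)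
  where
  go : ∀ n (rec : Acc _<_ n) → n ≤ 2 ^ ⌈log2⌉ n rec
  go zero          _        = z≤n
  go (suc zero)    _        = ≤-refl
  go (suc (suc n)) (acc rs) = ≤-trans double (*-monoʳ-≤ 2 (go (suc ⌈ n /2⌉) _))
    where
    open ≤-Reasoning
    double : suc (suc n) ≤ 2 * suc ⌈ n /2⌉
    double = begin
      suc (suc n)                     ≡⟨ cong (2 +_) (sym (⌊n/2⌋+⌈n/2⌉≡n n)) ⟩
      2 + (⌊ n /2⌋ + ⌈ n /2⌉)         ≤⟨ +-monoʳ-≤ 2 (+-monoˡ-≤ ⌈ n /2⌉ (⌊n/2⌋≤⌈n/2⌉ n)) ⟩
      2 + (⌈ n /2⌉ + ⌈ n /2⌉)         ≡⟨ rearrange ⌈ n /2⌉ ⟩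
      2 * suc ⌈ n /2⌉                 ∎
      where
      rearrange : ∀ h → 2 + (h + h) ≡ 2 * suc h
      rearrange = solve-∀

1≤⌈log₂n⌉ : ∀ {n} → 2 ≤ n → 1 ≤ ⌈log₂ n ⌉
1≤⌈log₂n⌉ = ⌈log₂⌉-mono-≤

1≤ceilSqrt : ∀ {m} → 1 ≤ m → 1 ≤ ceilSqrt m
1≤ceilSqrt {m} 1≤m with ceilSqrt m | m≤ceilSqrt² m
... | zero  | m≤0 = ≤-trans 1≤m m≤0
... | suc _ | _   = s≤s z≤n

n≤2^n : ∀ n → n ≤ 2 ^ n
n≤2^n zero    = z≤n
n≤2^n (suc n) = begin
  1 + n           ≤⟨ +-mono-≤ (m^n>0 2 n) (n≤2^n n) ⟩
  2 ^ n + 2 ^ n   ≡⟨ cong (2 ^ n +_) (sym (+-identityʳ (2 ^ n))) ⟩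
  2 ^ suc n       ∎
  where open ≤-Reasoning

module Constants (d : ℕ) where

  -- `g₀` absorbs the exponent of the Ramsey step and the factor `4 * q` of `select`; `b₀` is the
  -- solution of the inequality `badExponent`; `c` is the total `b₀ + g₀ + 1` times the ratio
  -- `2 * d` between `t` and the square root of the logarithm.
  q g₀ b₀ c : ℕ
  q  = suc d
  g₀ = 6 * q * suc q + (2 + q)
  b₀ = 2 + 2 * q * q + g₀ + 1 + 2 * d
  c  = (b₀ + g₀ + 1) * (2 * d)

  module _ (t : ℕ) (1≤t : 1 ≤ t) where
    open ≤-Reasoning

    1≤t² : 1 ≤ t * t
    1≤t² = *-mono-≤ 1≤t 1≤t

    scale : ∀ m → m ≤ m * (t * t)
    scale m = ≤-trans (≤-reflexive (sym (*-identityʳ m))) (*-monoʳ-≤ m 1≤t²)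

    homExponent : 2 + q + (q + q) * ((t + 2) * suc (q * t)) ≤ g₀ * t * t
    homExponent = begin
      2 + q + (q + q) * ((t + 2) * suc (q * t))
        ≤⟨ +-mono-≤ (scale (2 + q)) (*-monoʳ-≤ (q + q) (*-mono-≤
             (+-monoʳ-≤ t (*-monoʳ-≤ 2 1≤t)) (+-monoˡ-≤ (q * t) 1≤t))) ⟩
      (2 + q) * (t * t) + (q + q) * ((t + 2 * t) * (t + q * t))
        ≡⟨ collect q t ⟩
      g₀ * t * t ∎
      where
      collect : ∀ q t → (2 + q) * (t * t) + (q + q) * ((t + 2 * t) * (t + q * t)) ≡ (6 * q * suc q + (2 + q)) * t * t
      collect = solve-∀

    -- `b₀` is on both sides because the host graph grows with `2 ^ b`. As `2 * d ≤ t`, its term on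
    -- the left costs only half of `b₀ * t * t`, and the other half is what the remaining terms
    -- amount to.
    badExponent : 2 * d ≤ t → 1 + q * q + (b₀ * t + g₀ * t + t) * d + t * t * d ≤ b₀ * t * t
    badExponent 2d≤t = *-cancelˡ-≤ 2 (begin
      2 * (1 + q * q + (b₀ * t + g₀ * t + t) * d + t * t * d)
        ≡⟨ expand q d b₀ g₀ t ⟩
      2 + 2 * q * q + (b₀ + g₀ + 1) * t * (2 * d) + 2 * d * (t * t)
        ≤⟨ +-monoˡ-≤ (2 * d * (t * t)) (+-mono-≤ (scale (2 + 2 * q * q)) (*-monoʳ-≤ ((b₀ + g₀ + 1) * t) 2d≤t)) ⟩
      (2 + 2 * q * q) * (t * t) + (b₀ + g₀ + 1) * t * t + 2 * d * (t * t)
        ≡⟨ collect (2 + 2 * q * q) b₀ g₀ d t ⟩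
      b₀ * t * t + (2 + 2 * q * q + g₀ + 1 + 2 * d) * t * t
        ≡⟨ cong (b₀ * t * t +_) (sym (+-identityʳ (b₀ * t * t))) ⟩
      2 * (b₀ * t * t) ∎)
      where
      expand : ∀ q d b g t → 2 * (1 + q * q + (b * t + g * t + t) * d + t * t * d) ≡
                             2 + 2 * q * q + (b + g + 1) * t * (2 * d) + 2 * d * (t * t)
      expand = solve-∀
      collect : ∀ k b g d t → k * (t * t) + (b + g + 1) * t * t + 2 * d * (t * t) ≡
                              b * t * t + (k + g + 1 + 2 * d) * t * t
      collect = solve-∀

-- Assembling the monochromatic copy

placed⇒copy : ∀ {d Δ n} {V : Set} {H : Graph n} (R : V → V → Bool) → (∀ x y → R x y ≡ R y x) →
  (order : VertexOrder d Δ H) → let open VertexOrder order in {place : ℕ → V} →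
  (∀ {a c} → a < c → c < n → place a ≢ place c) →
  (∀ {a c} → a < c → c < n → adj H (at a) (at c) ≡ true → R (place a) (place c) ≡ true) →
  ∃[ f ] (Injective _≡_ _≡_ f × (∀ v w → adj H v w ≡ true → R (f v) (f w) ≡ true))
placed⇒copy {n = n} {V} {H} R R-sym order {place} distinct edges =
  (λ v → place (proj₁ (position v))) , (λ {v} {w} → injective (position v) (position w)) ,
  (λ v w → homomorphism (position v) (position w))
  where
  open VertexOrder order
  Position : Fin n → Set
  Position v = ∃[ a ] (a < n × at a ≡ v)

  injective : ∀ {v w} ((a , _) : Position v) ((c , _) : Position w) → place a ≡ place c → v ≡ w
  injective (a , a<n , refl) (c , c<n , refl) eq with <-cmp a c
  ... | tri< a<c _ _ = contradiction eq (distinct a<c c<n)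
  ... | tri≈ _ a≡c _ = cong at a≡c
  ... | tri> _ _ c<a = contradiction (sym eq) (distinct c<a a<n)

  homomorphism : ∀ {v w} ((a , _) : Position v) ((c , _) : Position w) → adj H v w ≡ true → R (place a) (place c) ≡ true
  homomorphism (a , a<n , refl) (c , c<n , refl) vw with <-cmp a c
  ... | tri< a<c _ _  = edges a<c c<n vw
  ... | tri≈ _ refl _ = contradiction (trans (sym vw) (irrefl H (at a))) λ ()
  ... | tri> _ _ c<a  = trans (R-sym _ _) (edges c<a a<n (trans (Graph.sym H (at c) (at a)) vw))

module Main (d t n : ℕ) (1≤t : 1 ≤ t) (2d≤t : 2 * d ≤ t) (1≤n : 1 ≤ n) where
  open Constants d
  open ≤-Reasoning

  -- Target sets have density at least `2 ^ -g`, and common neighbourhoods in them relative density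
  -- at least `2 ^ -b`. The extra `t` in `μ` pays for the factor 2 in `roomy`.
  b g μ D : ℕ
  b = b₀ * t
  g = g₀ * t
  μ = b + g + t
  D = 2 ^ (t * t)

  module _ (N : ℕ) (N≡ : N ≡ 2 ^ μ * n) (R : Fin N → Fin N → Bool) (R-sym : ∀ x y → R x y ≡ R y x) where

    private
      vs = allFin N

      instance
        t≢0 : NonZero t
        t≢0 = >-nonZero 1≤t
        n≢0 : NonZero n
        n≢0 = >-nonZero 1≤n
        2^μ≢0 : NonZero (2 ^ μ)
        2^μ≢0 = m^n≢0 2 μ
        D≢0 : NonZero D
        D≢0 = m^n≢0 2 (t * t)
        N≢0 : NonZero N
        N≢0 = subst NonZero (sym N≡) (m*n≢0 (2 ^ μ) n)
        length≢0 : NonZero (length vs)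
        length≢0 = subst NonZero (sym (length-allFin N)) N≢0

    open Size vs
    open HomCount vs t using (#hom; module Ramsey)
    open Selection vs t q R R-sym b g using (#Hom; #hom≤#Hom; U; select)
    open Extensions vs {q} R b using (#bad)

    manyHom : Ramsey.Many q R (λ _ → true) q ((q + q) * Ramsey.e q) →
              4 * q * length vs ^ (q * t) ≤ 2 ^ (g * t) * #Hom
    manyHom many = begin
      4 * q * length vs ^ (q * t)
        ≤⟨ *-mono-≤ (*-monoʳ-≤ 4 (n≤2^n q)) (≤-reflexive (cong (_^ (q * t)) (sym (trans (∑-const vs 1) (*-identityʳ _))))) ⟩
      2 ^ 2 * 2 ^ q * size (λ _ → true) ^ (q * t)
        ≤⟨ *-mono-≤ (≤-reflexive (sym (^-distribˡ-+-* 2 2 q))) many ⟩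
      2 ^ (2 + q) * (2 ^ E * #hom R (λ _ → true) q)
        ≡⟨ trans (sym (*-assoc (2 ^ (2 + q)) (2 ^ E) _)) (cong (_* #hom R (λ _ → true) q) (sym (^-distribˡ-+-* 2 (2 + q) E))) ⟩
      2 ^ (2 + q + E) * #hom R (λ _ → true) q
        ≤⟨ *-mono-≤ (^-monoʳ-≤ 2 (homExponent t 1≤t)) (#hom≤#Hom (λ _ → true)) ⟩
      2 ^ (g * t) * #Hom ∎
      where
      E = (q + q) * ((t + 2) * suc (q * t))

    roomy : ∀ (A : Fin N → Bool) → length vs ≤ 2 ^ g * size A → 2 ^ b * (n + n) ≤ size A
    roomy A large = *-cancelˡ-≤ (2 ^ g) {{m^n≢0 2 g}} (begin
      2 ^ g * (2 ^ b * (n + n))       ≡⟨ double (2 ^ g) (2 ^ b) n ⟩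
      2 ^ b * 2 ^ g * 2 * n           ≤⟨ *-monoˡ-≤ n (*-monoʳ-≤ (2 ^ b * 2 ^ g) (^-monoʳ-≤ 2 1≤t)) ⟩
      2 ^ b * 2 ^ g * 2 ^ t * n       ≡⟨ cong (_* n) (trans (cong (_* 2 ^ t) (sym (^-distribˡ-+-* 2 b g))) (sym (^-distribˡ-+-* 2 (b + g) t))) ⟩
      2 ^ μ * n                       ≡⟨ sym (trans (length-allFin N) N≡) ⟩
      length vs                       ≤⟨ large ⟩
      2 ^ g * size A                  ∎)
      where
      double : ∀ g b n → g * (b * (n + n)) ≡ b * g * 2 * n
      double = solve-∀

    -- The conclusion is the starting invariant `Good d []` for `M = n`. With `q` bounded by
    -- `2 ^ q`, everything but `n ^ d` is a power of 2, and `badExponent` compares the exponents.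
    initiallyGood : ∀ B → 2 ^ (b * t) * B < 2 * (q * (q * length vs) ^ d) → B * D ^ d < n ^ d
    initiallyGood B few = *-cancelˡ-< (2 ^ (b * t)) _ _ (begin-strict
      2 ^ (b * t) * (B * D ^ d)
        ≡⟨ sym (*-assoc (2 ^ (b * t)) B _) ⟩
      2 ^ (b * t) * B * D ^ d
        <⟨ *-monoˡ-< (D ^ d) {{m^n≢0 D d}} few ⟩
      2 * (q * (q * length vs) ^ d) * D ^ d
        ≡⟨ cong₂ (λ x y → 2 * (q * x) * y) power (^-*-assoc 2 (t * t) d) ⟩
      2 * (q * (q ^ d * (2 ^ (μ * d) * n ^ d))) * 2 ^ (t * t * d)
        ≡⟨ rearrange (q ^ suc d) q (q ^ d) (2 ^ (μ * d)) (n ^ d) (2 ^ (t * t * d)) refl ⟩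
      2 * q ^ suc d * 2 ^ (μ * d) * 2 ^ (t * t * d) * n ^ d
        ≤⟨ *-monoˡ-≤ (n ^ d) (*-monoˡ-≤ (2 ^ (t * t * d)) (*-monoˡ-≤ (2 ^ (μ * d)) (*-monoʳ-≤ 2 (^-monoˡ-≤ (suc d) (n≤2^n q))))) ⟩
      2 * (2 ^ q) ^ suc d * 2 ^ (μ * d) * 2 ^ (t * t * d) * n ^ d
        ≡⟨ cong (_* n ^ d) exponents ⟩
      2 ^ (1 + q * q + μ * d + t * t * d) * n ^ d
        ≤⟨ *-monoˡ-≤ (n ^ d) (^-monoʳ-≤ 2 (badExponent t 1≤t 2d≤t)) ⟩
      2 ^ (b * t) * n ^ d ∎)
      where
      power : (q * length vs) ^ d ≡ q ^ d * (2 ^ (μ * d) * n ^ d)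
      power = begin-equality
        (q * length vs) ^ d              ≡⟨ cong (λ x → (q * x) ^ d) (trans (length-allFin N) N≡) ⟩
        (q * (2 ^ μ * n)) ^ d            ≡⟨ ^-distribʳ-* q (2 ^ μ * n) d ⟩
        q ^ d * (2 ^ μ * n) ^ d          ≡⟨ cong (q ^ d *_) (^-distribʳ-* (2 ^ μ) n d) ⟩
        q ^ d * ((2 ^ μ) ^ d * n ^ d)    ≡⟨ cong (λ x → q ^ d * (x * n ^ d)) (^-*-assoc 2 μ d) ⟩
        q ^ d * (2 ^ (μ * d) * n ^ d)    ∎
      rearrange : ∀ Q q r x y z → q * r ≡ Q → 2 * (q * (r * (x * y))) * z ≡ 2 * Q * x * z * y
      rearrange Q q r x y z refl = go q r x y z
        where
        go : ∀ q r x y z → 2 * (q * (r * (x * y))) * z ≡ 2 * (q * r) * x * z * y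
        go = solve-∀
      exponents : 2 * (2 ^ q) ^ suc d * 2 ^ (μ * d) * 2 ^ (t * t * d) ≡ 2 ^ (1 + q * q + μ * d + t * t * d)
      exponents = sym (trans (^-distribˡ-+-* 2 (1 + q * q + μ * d) (t * t * d))
        (cong (_* 2 ^ (t * t * d)) (trans (^-distribˡ-+-* 2 (1 + q * q) (μ * d))
          (cong (λ x → 2 * x * 2 ^ (μ * d)) (sym (^-*-assoc 2 q q))))))

    embeds : Ramsey.Many q R (λ _ → true) q ((q + q) * Ramsey.e q) →
             ∀ (H : Graph n) {Δ} → Δ ≤ D → VertexOrder d Δ H →
             ∃[ f ] (Injective _≡_ _≡_ f × (∀ i j → adj H i j ≡ true → R (f i) (f j) ≡ true))
    embeds many H Δ≤D order =
      let T , large , few = select d (manyHom many)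
          _ , placement = embedInto T large few
      in placed⇒copy R R-sym order (Embedding.Partial.distinct placement) (Embedding.Partial.edges placement)
      where
      open VertexOrder order

      traces : FewTraces (λ a c → adj H (at a) (at c)) D n
      traces k k<n = let L , short , complete = fewTraces k k<n in L , ≤-trans short Δ≤D , complete

      embedInto : ∀ T (large : ∀ i → length vs ≤ 2 ^ g * size (U T i)) →
        2 ^ (b * t) * ∑ (allFin q) (λ i → #bad (U T) i d []) < 2 * (q * (q * length vs) ^ d) →
        ∃[ f ] Embedding.Partial R (U T) d b n n D ≤-refl (λ i → roomy (U T i) (large i))
                 (λ a c → adj H (at a) (at c)) fewBack traces n f
      embedInto T large few = Embedding.embedUpTo R (U T) d b n n D ≤-refl (λ i → roomy (U T i) (large i))
        (λ a c → adj H (at a) (at c)) fewBack traces (zero , fromℕ< (>-nonZero⁻¹ N)) (initiallyGood _ few) n ≤-refl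

VertexOrder⇒Arrows : ∀ d t₀ {Δ n} (H : Graph n) → 1 ≤ d → 1 ≤ t₀ → 1 ≤ n → Δ ≤ 2 ^ (t₀ * t₀) →
                     VertexOrder d Δ H → Arrows (2 ^ (Constants.c d * t₀) * n) H
VertexOrder⇒Arrows d t₀ {Δ} {n} H 1≤d 1≤t₀ 1≤n Δ≤ order col col-sym =
  decide (Ramsey.Colouring.ramsey q R cover q q (λ _ → true) ≤-refl ≤-refl)
  where
  open Constants d
  N = 2 ^ (c * t₀) * n
  -- The factor `2 * d` secures the hypothesis `2 * d ≤ t` of `badExponent`.
  t = 2 * d * t₀
  1≤2d : 1 ≤ 2 * d
  1≤2d = *-mono-≤ {1} {2} (s≤s z≤n) 1≤d
  1≤t : 1 ≤ t
  1≤t = *-mono-≤ 1≤2d 1≤t₀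
  instance
    t≢0 : NonZero t
    t≢0 = >-nonZero 1≤t
  t₀≤t : t₀ ≤ t
  t₀≤t = ≤-trans (≤-reflexive (sym (*-identityˡ t₀))) (*-monoˡ-≤ t₀ 1≤2d)

  open HomCount (allFin N) t using (module Ramsey)
  open Main d t n 1≤t (≤-trans (≤-reflexive (sym (*-identityʳ (2 * d)))) (*-monoʳ-≤ (2 * d) 1≤t₀)) 1≤n using (embeds; μ; D)

  R : Bool → Fin N → Fin N → Bool
  R colour x y = ⌊ col x y Bool.≟ colour ⌋

  cover : ∀ x y → R true x y ≡ true ⊎ R false x y ≡ true
  cover x y with col x y
  ... | true  = inj₁ refl
  ... | false = inj₂ refl

  N≡ : N ≡ 2 ^ μ * n
  N≡ = cong (λ e → 2 ^ e * n) (collect b₀ g₀ d t₀)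
    where
    collect : ∀ b g d t → (b + g + 1) * (2 * d) * t ≡ b * (2 * d * t) + g * (2 * d * t) + 2 * d * t
    collect = solve-∀

  Δ≤D : Δ ≤ D
  Δ≤D = ≤-trans Δ≤ (^-monoʳ-≤ 2 (*-mono-≤ t₀≤t t₀≤t))

  copy : ∀ colour → Ramsey.Many q (R colour) (λ _ → true) q ((q + q) * Ramsey.e q) → MonoCopy H col
  copy colour many =
    let f , f-inj , f-edges = embeds N N≡ (R colour) (λ x y → cong (λ z → ⌊ z Bool.≟ colour ⌋) (col-sym x y)) many H Δ≤D order
    in colour , f , f-inj , λ i j ij → ⌊⌋-true (col (f i) (f j) Bool.≟ colour) (f-edges i j ij)

  decide : Ramsey.Many q (R true) (λ _ → true) q ((q + q) * Ramsey.e q) ⊎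
           Ramsey.Many q (R false) (λ _ → true) q ((q + q) * Ramsey.e q) → MonoCopy H col
  decide (inj₁ many) = copy true many
  decide (inj₂ many) = copy false many

theorem1p1 : (d : ℕ) → 1 ≤ d →
    ∃[ c ]
    (((Δ n : ℕ) (H : Graph n) → 1 ≤ n → 2 ≤ Δ → DDegenerate d Δ H →
    Arrows (2 ^ (c * ceilSqrt ⌈log₂ Δ ⌉) * n) H)
    × ((n : ℕ) (H : Graph n) → 1 ≤ n → Degenerate d H →
    Arrows (2 ^ (c * ceilSqrt ⌈log₂ n ⌉) * n) H))
theorem1p1 d 1≤d = Constants.c d , dDegenerate , degenerate
  where
  bound : ∀ {Δ n} (H : Graph n) → 1 ≤ n → 2 ≤ Δ → VertexOrder d Δ H →
          Arrows (2 ^ (Constants.c d * ceilSqrt ⌈log₂ Δ ⌉) * n) H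
  bound {Δ} H 1≤n 2≤Δ = VertexOrder⇒Arrows d (ceilSqrt ⌈log₂ Δ ⌉) H 1≤d (1≤ceilSqrt (1≤⌈log₂n⌉ 2≤Δ)) 1≤n
    (≤-trans (n≤2^⌈log₂n⌉ Δ) (^-monoʳ-≤ 2 (m≤ceilSqrt² ⌈log₂ Δ ⌉)))

  dDegenerate : (Δ n : ℕ) (H : Graph n) → 1 ≤ n → 2 ≤ Δ → DDegenerate d Δ H →
                Arrows (2 ^ (Constants.c d * ceilSqrt ⌈log₂ Δ ⌉) * n) H
  dDegenerate Δ n H 1≤n 2≤Δ ddeg = bound H 1≤n 2≤Δ (DDegenerate⇒VertexOrder H 1≤n ddeg)

  degenerate : (n : ℕ) (H : Graph n) → 1 ≤ n → Degenerate d H →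
               Arrows (2 ^ (Constants.c d * ceilSqrt ⌈log₂ n ⌉) * n) H
  -- For `n = 1` the logarithm is 0, which `bound` does not cover; a single vertex has no edges to
  -- embed.
  degenerate (suc zero) H _ _ col _ = true , (λ _ → vertex) , (λ { {zero} {zero} _ → refl }) ,
    λ { zero zero loop → contradiction (trans (sym loop) (irrefl H zero)) λ () }
    where
    vertex : Fin (2 ^ (Constants.c d * 0) * 1)
    vertex = fromℕ< (*-mono-≤ (m^n>0 2 (Constants.c d * 0)) ≤-refl)
  degenerate (suc (suc n)) H 1≤n deg = bound H 1≤n (s≤s (s≤s z≤n)) (Degenerate⇒VertexOrder H deg 1≤n)
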